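{- Let $H$ be a graph with $\chi(H)=r\ge 3$. Then $$\delta_{\chi}^{\mathrm{VC}}(H)\in\left\{\frac{r-3}{r-2},\ \frac{r-2}{r-1}\right\},$$ and the larger value $\frac{r-2}{r-1}$ occurs if and only if the decomposition family $\mathcal M(H)$ contains no forest.
   Context: All graphs are finite and simple. A graph is $H$-free if it contains no (not necessarily induced) subgraph isomorphic to $H$. $\delta(G)$ denotes minimum degree and $\chi$ the chromatic number. The VC-dimension $\mathrm{VC}(G)$ of a graph $G$ is the maximum size of a set $S\subseteq V(G)$ such that $\{N_G(v)\cap S: v\in V(G)\}=2^S$. The bounded-VC chromatic threshold $\delta_\chi^{\mathrm{VC}}(H)$ is the infimum of all $\gamma>0$ such that, for every integer $d\ge 1$, there is a constant $C=C(\gamma,d,H)$ such that every $H$-free graph $G$ with $\delta(G)\ge\gamma|V(G)|$ and $\mathrm{VC}(G)\le d$ has $\chi(G)\le C$. For a graph $H$ with $\chi(H)=r$, the decomposition family $\mathcal M(H)$ consists of all graphs $H[B]$ arising from a partition $V(H)=A_1\cup\cdots\cup A_{r-2}\cup B$ in which $A_1,\dots,A_{r-2}$ are independent sets of $H$. -}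

module Defs where

open import Data.Bool using (Bool; true; false)
open import Data.Empty using (⊥)
open import Data.Fin using (Fin; zero; suc; inject₁; fromℕ)
open import Data.Fin.Subset using (Subset; _∩_; _⊆_; ∣_∣)
open import Data.Integer using (+_)
open import Data.List using (map; allFin)
open import Data.List.Extrema using (min)
open import Data.Maybe using (Maybe; just; nothing)
open import Data.Nat using (ℕ; zero; suc; _∸_; _≤_; _≥_)
open import Data.Nat.Properties using (≤-totalOrder)
open import Data.Product using (∃; ∃-syntax; Σ-syntax; _×_; _,_)
open import Data.Rational using (ℚ; 0ℚ; 1ℚ; _/_) renaming (_<_ to _<ℚ_; _≤_ to _≤ℚ_; _*_ to _*ℚ_; _+_ to _+ℚ_; -_ to -ℚ_)
open import Data.Rational.Properties using (<-dense; <-trans; <-irrefl; _<?_; ≮⇒≥; ≤-<-trans; +-monoʳ-<; +-identityʳ)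
open import Data.Sum using (_⊎_; inj₁; inj₂)
open import Data.Vec using (tabulate)
open import Function.Bundles using (_⇔_)
open import Function.Definitions using (Injective)
open import Relation.Binary.PropositionalEquality using (_≡_; _≢_; refl; subst)
open import Relation.Nullary using (¬_; yes; no; from-yes)

-- Located two-sided Dedekind cuts.
record ℝ : Set₁ where
  field
    L U         : ℚ → Set
    L-inhabited : ∃ L
    U-inhabited : ∃ U
    L-lower     : ∀ {p q} → p <ℚ q → L q → L p
    L-open      : ∀ {p} → L p → ∃[ q ] (p <ℚ q × L q)
    U-upper     : ∀ {p q} → p <ℚ q → U p → U q
    U-open      : ∀ {q} → U q → ∃[ p ] (p <ℚ q × U p)
    disjoint    : ∀ {q} → L q → U q → ⊥
    located     : ∀ {p q} → p <ℚ q → L p ⊎ U q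

fromℚ : ℚ → ℝ
fromℚ x = record
  { L           = _<ℚ x
  ; U           = x <ℚ_
  ; L-inhabited = x +ℚ (-ℚ 1ℚ) , subst (x +ℚ (-ℚ 1ℚ) <ℚ_) (+-identityʳ x) (+-monoʳ-< x (from-yes ((-ℚ 1ℚ) <? 0ℚ)))
  ; U-inhabited = x +ℚ 1ℚ , subst (_<ℚ x +ℚ 1ℚ) (+-identityʳ x) (+-monoʳ-< x (from-yes (0ℚ <? 1ℚ)))
  ; L-lower     = <-trans
  ; L-open      = λ p<x → let (m , p<m , m<x) = <-dense p<x in m , p<m , m<x
  ; U-upper     = λ p<q x<p → <-trans x<p p<q
  ; U-open      = λ x<q → let (m , x<m , m<q) = <-dense x<q in m , m<q , x<m
  ; disjoint    = λ q<x x<q → <-irrefl refl (<-trans q<x x<q)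
  ; located     = loc
  }
  where
  loc : ∀ {p q} → p <ℚ q → p <ℚ x ⊎ x <ℚ q
  loc {p} p<q with p <? x
  ... | yes p<x = inj₁ p<x
  ... | no  p≮x = inj₂ (≤-<-trans (≮⇒≥ p≮x) p<q)

_≤ℝ_ : ℝ → ℝ → Set
x ≤ℝ y = ∀ q → ℝ.L x q → ℝ.L y q

Positive : ℝ → Set
Positive x = ℝ.L x 0ℚ

-- x · n ≤ m as real numbers: since n ≥ 0, this holds iff q · n ≤ m for
-- every rational q < x.
_·_≤ℕ_ : ℝ → ℕ → ℕ → Set
x · n ≤ℕ m = ∀ q → ℝ.L x q → q *ℚ (+ n / 1) ≤ℚ (+ m / 1)

IsInfimum : (ℝ → Set) → ℝ → Set₁
IsInfimum P x = (∀ y → P y → x ≤ℝ y) × (∀ z → (∀ y → P y → z ≤ℝ y) → z ≤ℝ x)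

-- Division of naturals with value in ℚ, with the junk value m ÷ 0 = 0.
_÷_ : ℕ → ℕ → ℚ
m ÷ zero  = 0ℚ
m ÷ suc n = + m / suc n

record Graph : Set where
  field
    order  : ℕ
    adj    : Fin order → Fin order → Bool
    symm   : ∀ u v → adj u v ≡ adj v u
    irrefl : ∀ v → adj v v ≡ false

open Graph public using (order)

Vertex : Graph → Set
Vertex G = Fin (order G)

Adj : (G : Graph) → Vertex G → Vertex G → Set
Adj G u v = Graph.adj G u v ≡ true

N : (G : Graph) → Vertex G → Subset (order G)
N G v = tabulate (Graph.adj G v)

degree : (G : Graph) → Vertex G → ℕ
degree G v = ∣ N G v ∣

-- The default value `order G` exceeds every degree, so it is only attained
-- by the graph with no vertices, whose minimum degree is thus 0.
δ : Graph → ℕ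
δ G = min ≤-totalOrder (order G) (map (degree G) (allFin (order G)))

-- An isomorphism from H onto a (not necessarily induced) subgraph of G.
record Copy (H G : Graph) : Set where
  field
    to        : Vertex H → Vertex G
    injective : Injective _≡_ _≡_ to
    preserves : ∀ {u v} → Adj H u v → Adj G (to u) (to v)

_-Free_ : Graph → Graph → Set
H -Free G = ¬ Copy H G

IsMinimum : (ℕ → Set) → ℕ → Set
IsMinimum P k = P k × (∀ j → P j → k ≤ j)

IsMaximum : (ℕ → Set) → ℕ → Set
IsMaximum P k = P k × (∀ j → P j → j ≤ k)

Colourable : Graph → ℕ → Set
Colourable G k = Σ[ c ∈ (Vertex G → Fin k) ] (∀ u v → Adj G u v → c u ≢ c v)

HasChromaticNumber : Graph → ℕ → Set
HasChromaticNumber G = IsMinimum (Colourable G)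

-- { N(v) ∩ S : v ∈ V(G) } = 2^S
Shattered : (G : Graph) → Subset (order G) → Set
Shattered G S = ∀ T → (∃[ v ] N G v ∩ S ≡ T) ⇔ T ⊆ S

-- The graph with no vertices shatters no set and has no VC-dimension.
HasVCDimension : Graph → ℕ → Set
HasVCDimension G = IsMaximum (λ k → ∃[ S ] (Shattered G S × ∣ S ∣ ≡ k))

Admissible : Graph → ℝ → Set
Admissible H γ =
  Positive γ ×
  (∀ d → d ≥ 1 → ∃[ C ] (∀ G →
    H -Free G →
    γ · order G ≤ℕ δ G →
    (∃[ m ] (HasVCDimension G m × m ≤ d)) →
    ∃[ k ] (HasChromaticNumber G k × k ≤ C)))

-- δ_χ^VC(H) = x
HasBoundedVCThreshold : Graph → ℝ → Set₁
HasBoundedVCThreshold H = IsInfimum (Admissible H)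

-- F ≅ H[B]
record IsInduced (F H : Graph) (B : Vertex H → Set) : Set where
  field
    to        : Vertex F → Vertex H
    injective : Injective _≡_ _≡_ to
    image     : ∀ v → B v ⇔ (∃[ i ] to i ≡ v)
    adjacency : ∀ u v → Graph.adj F u v ≡ Graph.adj H (to u) (to v)

-- F ∈ 𝓜(H), where r = χ(H).  A partition V(H) = A₁ ∪ ⋯ ∪ A_{r-2} ∪ B is a
-- map `part` with A_i = part⁻¹(just i) and B = part⁻¹(nothing); parts may
-- be empty.  The family is closed under isomorphism.
record DecompositionFamily (H : Graph) (r : ℕ) (F : Graph) : Set where
  field
    part        : Vertex H → Maybe (Fin (r ∸ 2))
    independent : ∀ i u v → part u ≡ just i → part v ≡ just i → ¬ Adj H u v
    induced     : IsInduced F H (λ v → part v ≡ nothing)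

-- A cycle of length 3 + m.
record Cycle (G : Graph) (m : ℕ) : Set where
  field
    vertex    : Fin (suc (suc (suc m))) → Vertex G
    injective : Injective _≡_ _≡_ vertex
    step      : ∀ (i : Fin (suc (suc m))) → Adj G (vertex (inject₁ i)) (vertex (suc i))
    close     : Adj G (vertex (fromℕ (suc (suc m)))) (vertex zero)

Forest : Graph → Set
Forest G = ∀ m → ¬ Cycle G m

{-# OPTIONS --safe #-}
module Submission where

-- Lower bounds.  Put a graph of large girth and large chromatic number into one
-- part of a balanced complete (p + 1)-partite graph.  The minimum degree is at
-- least p / (p + 1) of the order, the VC-dimension is bounded because the graph
-- inside the part has no 4-cycle, and a copy of H meets that part in a forest.
-- For p = r - 2 this puts a forest into 𝓜(H); for p = r - 3 the forest is
-- 2-colourable, so H would be (r - 1)-colourable.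
--
-- Upper bounds.  Above (r - 2) / (r - 1) the Erdős–Stone theorem bounds the
-- order.  If 𝓜(H) contains a forest F, bounded VC-dimension splits the vertices
-- into boundedly many classes of nearly equal neighbourhoods.  A class of large
-- chromatic number contains F, and above (r - 3) / (r - 2) the common
-- neighbourhood of that copy is dense enough to contain a complete
-- (r - 2)-partite graph, which completes F to a copy of H.

open import Data.Bool using (Bool; true; false; not; _∧_; _∨_; _xor_; if_then_else_)
open import Data.Bool.Properties using (∧-comm; xor-comm) renaming (_≟_ to _≟ᵇ_)
open import Data.Empty using (⊥; ⊥-elim)
open import Data.Fin using (Fin; zero; suc; toℕ; fromℕ; fromℕ<; inject₁; inject≤; punchIn; combine; quotient; remainder; finToFun; funToFin; _↑ˡ_; _↑ʳ_; splitAt) renaming (_≟_ to _≟ᶠ_)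
open import Data.Fin.Patterns using (0F; 1F; 2F; 3F)
open import Data.Fin.Properties using (any?; all?; ¬∀⟶∃¬; toℕ-injective; injective⇒≤; pigeonhole; inject≤-injective; toℕ-inject≤; toℕ-inject₁; toℕ-fromℕ; toℕ-fromℕ<; toℕ<n; suc-injective; remQuot-combine; combine-remQuot; combine-injective; finToFun-funToFin; ↑ˡ-injective; ↑ʳ-injective; splitAt-↑ˡ; splitAt-↑ʳ; punchIn-injective; punchInᵢ≢i; <⇒≢)
open import Data.Fin.Relation.Unary.Top using (view; ‵fromℕ; ‵inj₁; view-fromℕ; view-inject₁)
open import Data.Fin.Subset using (_∩_; _⊆_; ∣_∣) renaming (⊥ to ⊥ˢ)
open import Data.Fin.Subset.Properties using (anySubset?; p∩q⊆q; _⊆?_; ∩-zeroʳ; ⊆-antisym; ⊆-min)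
import Data.Integer as ℤ
import Data.Integer.Properties as ℤ
open import Data.List using (List; []; _∷_; length; map; filter; allFin; _++_) renaming (tabulate to tabulateᴸ)
open import Data.List.Extrema using (v≤min⁺; min≤xs)
open import Data.List.Membership.Propositional using (find; lose) renaming (_∈_ to _∈ᴸ_)
open import Data.List.Membership.Propositional.Properties using (∈-map⁺; ∈-map⁻; ∈-filter⁺; ∈-filter⁻; ∈-tabulate⁺; ∈-tabulate⁻; ∈-∃++; ∈-++⁺ˡ; ∈-++⁺ʳ; ∈-++⁻; ∈-allFin)
open import Data.List.Properties using (length-map; length-filter; length-tabulate; length-++)
import Data.List.Relation.Unary.All as All
import Data.List.Relation.Unary.All.Properties as All
open import Data.List.Relation.Unary.Any using (Any; here; there) renaming (any? to anyᴸ?)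
open import Data.Maybe using (Maybe; just; nothing; is-nothing)
open import Data.Maybe.Properties using () renaming (≡-dec to ≡-decᵐ)
open import Data.Nat using (ℕ; zero; suc; _+_; _*_; _∸_; _^_; _⊔_; _≤_; _<_; _≥_; z≤n; s≤s; NonZero)
open import Data.Nat.Properties hiding (<⇒≢; suc-injective; 0≢1+n)
open import Data.Nat.Tactic.RingSolver using (solve-∀)
open import Data.Product using (∃; ∃-syntax; Σ-syntax; _×_; _,_; proj₁; proj₂)
import Data.Rational as ℚ
open import Data.Rational using (ℚ; mkℚ)
import Data.Rational.Properties as ℚ
import Data.Rational.Unnormalised as ℚᵘ
import Data.Rational.Unnormalised.Properties as ℚᵘ
open import Data.Sum using (_⊎_; inj₁; inj₂; [_,_]′)
open import Data.Vec using (Vec; []; _∷_; lookup; tabulate)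
open import Data.Vec.Properties using (lookup∘tabulate; tabulate∘lookup; tabulate-cong; lookup-zipWith; []=⇒lookup; lookup⇒[]=) renaming (≡-dec to ≡-decᵛ)
open import Defs
open import Function.Base using (_∘_; id; case_of_; const)
open import Function.Bundles using (_⇔_; mk⇔; Equivalence)
open import Function.Definitions using (Injective)
open import Relation.Binary.Definitions using (tri<; tri≈; tri>)
open import Relation.Binary.PropositionalEquality using (_≡_; _≢_; refl; sym; trans; cong; cong₂; subst; subst₂; module ≡-Reasoning)
open import Relation.Nullary using (¬_; Dec; yes; no; does; contradiction; _×-dec_; _⊎-dec_; _→-dec_; ¬?)
open import Relation.Nullary.Decidable using (dec-true; dec-false; map′; does-⇔; decidable-stable)
open import Algebra.Properties.Semiring.Sum +-*-semiring using (sum; sum-cong-≗; ∑-distrib-+; ∑-comm; *-distribˡ-sum)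

-- Counting

-- All counting is done in natural numbers: a density is a pair of naturals compared by
-- cross-multiplication, and rational and real numbers enter only in the last part. Large girth
-- together with large chromatic number comes from an explicit recursion instead of a random graph,
-- so that the extremal graphs are constructed. The classes of nearly equal neighbourhoods come from
-- a packing bound: many vertices with pairwise distant neighbourhoods would have distinct traces on
-- few points, and so many traces shatter a large set. The theorem asserts a disjunction, so a
-- forest in 𝓜(H) has to be found or excluded by a finite search. Likewise the chromatic number and
-- the VC-dimension have to be exhibited as extrema, which calls for deciding colourability and
-- shattering.

infix 4 _holds

_holds : Bool → Set
b holds = b ≡ true

does⇒ : ∀ {A : Set} (a? : Dec A) → does a? holds → A
does⇒ (yes a) _ = a

∧-holds : ∀ {a b} → a holds → b holds → (a ∧ b) holds
∧-holds refl refl = refl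

∧-holdsˡ : ∀ {a b} → (a ∧ b) holds → a holds
∧-holdsˡ {true} _ = refl

∧-holdsʳ : ∀ {a b} → (a ∧ b) holds → b holds
∧-holdsʳ {true} b = b

bit : Bool → ℕ
bit true  = 1
bit false = 0

count : ∀ {n} → (Fin n → Bool) → ℕ
count P = sum (bit ∘ P)

sum-mono : ∀ {n} {f g : Fin n → ℕ} → (∀ i → f i ≤ g i) → sum f ≤ sum g
sum-mono {zero}  f≤g = z≤n
sum-mono {suc n} f≤g = +-mono-≤ (f≤g zero) (sum-mono (f≤g ∘ suc))

sum-≤-const : ∀ {n} {f : Fin n → ℕ} c → (∀ i → f i ≤ c) → sum f ≤ n * c
sum-≤-const {zero}  c f≤c = z≤n
sum-≤-const {suc n} c f≤c = +-mono-≤ (f≤c zero) (sum-≤-const c (f≤c ∘ suc))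

term≤sum : ∀ {n} (f : Fin n → ℕ) i → f i ≤ sum f
term≤sum f zero    = m≤m+n _ _
term≤sum f (suc i) = ≤-trans (term≤sum (f ∘ suc) i) (m≤n+m _ _)

exceeds-average : ∀ {n} (f : Fin n → ℕ) c → n * c < sum f → ∃[ i ] c < f i
exceeds-average f c nc<∑ with any? (λ i → c <? f i)
... | yes found = found
... | no  none  = contradiction (sum-≤-const c (λ i → ≮⇒≥ (λ c<fi → none (i , c<fi)))) (<⇒≱ nc<∑)

count-split : ∀ {n} (P Q : Fin n → Bool) →
  count P ≡ count (λ i → P i ∧ Q i) + count (λ i → P i ∧ not (Q i))
count-split P Q = trans (sum-cong-≗ (λ i → split (P i) (Q i))) (∑-distrib-+ (λ i → bit (P i ∧ Q i)) (λ i → bit (P i ∧ not (Q i))))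
  where
  split : ∀ p q → bit p ≡ bit (p ∧ q) + bit (p ∧ not q)
  split true  true  = refl
  split true  false = refl
  split false _     = refl

count-const-true : ∀ n → count {n} (const true) ≡ n
count-const-true zero    = refl
count-const-true (suc n) = cong suc (count-const-true n)

count-not : ∀ {n} (P : Fin n → Bool) → count P + count (not ∘ P) ≡ n
count-not P = trans (sym (count-split (const true) P)) (count-const-true _)

count-≤ : ∀ {n} (P : Fin n → Bool) → count P ≤ n
count-≤ P = ≤-trans (m≤m+n _ _) (≤-reflexive (count-not P))

record Enumeration {n} (P : Fin n → Bool) (m : ℕ) : Set where
  field
    element   : Fin m → Fin n
    injective : Injective _≡_ _≡_ element
    sound     : ∀ i → P (element i) holds
    complete  : ∀ v → P v holds → ∃[ i ] element i ≡ v

enumerate : ∀ {n} (P : Fin n → Bool) → Enumeration P (count P)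
enumerate {zero}  P = record
  { element = λ () ; injective = λ { {()} } ; sound = λ () ; complete = λ () }
enumerate {suc n} P with P zero in P0 | enumerate (P ∘ suc)
... | true | E = record { element = el ; injective = inj ; sound = snd ; complete = cmp }
  where
  open Enumeration E
  el : Fin (suc (count (P ∘ suc))) → Fin (suc n)
  el zero    = zero
  el (suc i) = suc (element i)
  inj : Injective _≡_ _≡_ el
  inj {zero}  {zero}  _  = refl
  inj {suc i} {suc j} eq = cong suc (injective (suc-injective eq))
  snd : ∀ i → P (el i) holds
  snd zero    = P0
  snd (suc i) = sound i
  cmp : ∀ v → P v holds → ∃[ i ] el i ≡ v
  cmp zero    _  = zero , refl
  cmp (suc v) Pv = let i , eq = complete v Pv in suc i , cong suc eq
... | false | E = record
  { element = suc ∘ element ; injective = injective ∘ suc-injective ; sound = sound ; complete = cmp }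
  where
  open Enumeration E
  cmp : ∀ v → P v holds → ∃[ i ] suc (element i) ≡ v
  cmp zero    Pv = contradiction (trans (sym P0) Pv) λ ()
  cmp (suc v) Pv = let i , eq = complete v Pv in i , cong suc eq

choose : ∀ {n} (P : Fin n → Bool) {t} → t ≤ count P →
  Σ[ e ∈ (Fin t → Fin n) ] (Injective _≡_ _≡_ e × (∀ i → P (e i) holds))
choose P t≤ = (λ i → element (inject≤ i t≤)) , (λ eq → inject≤-injective t≤ t≤ _ _ (injective eq)) , (λ i → sound _)
  where open Enumeration (enumerate P)

choose-one : ∀ {n} (P : Fin n → Bool) → 0 < count P → ∃[ v ] P v holds
choose-one P 0< = let e , _ , Pe = choose P 0< in e zero , Pe zero

injection⇒≤count : ∀ {n t} (P : Fin n → Bool) (e : Fin t → Fin n) →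
  Injective _≡_ _≡_ e → (∀ i → P (e i) holds) → t ≤ count P
injection⇒≤count P e e-inj Pe = injective⇒≤ {f = λ i → proj₁ (complete (e i) (Pe i))}
  (λ {i} {j} eq → e-inj (trans (sym (proj₂ (complete (e i) (Pe i))))
    (trans (cong element eq) (proj₂ (complete (e j) (Pe j))))))
  where open Enumeration (enumerate P)

count-positive : ∀ {n} (P : Fin n → Bool) v → P v holds → 0 < count P
count-positive P v Pv = injection⇒≤count P (const v) (λ { {0F} {0F} _ → refl }) (λ _ → Pv)

-- Otherwise each of the `count P` elements of `P` is a value of `e`, and choosing an index for each
-- injects them into `Fin t`. This is the greedy step in the colouring, in the prolongation of paths
-- and in the forest embedding.
fresh : ∀ {n t} (P : Fin n → Bool) (e : Fin t → Fin n) → t < count P →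
  ∃[ v ] (P v holds × (∀ i → e i ≢ v))
fresh {n} {t} P e t< with any? (λ v → (P v ≟ᵇ true) ×-dec all? (λ i → ¬? (e i ≟ᶠ v)))
... | yes found = found
... | no  none  = contradiction (injective⇒≤ {f = proj₁ ∘ hit} hit-inj) (<⇒≱ t<)
  where
  open Enumeration (enumerate P)
  hit : ∀ j → ∃[ i ] e i ≡ element j
  hit j with any? (λ i → e i ≟ᶠ element j)
  ... | yes h = h
  ... | no ¬h = contradiction (element j , sound j , λ i eq → ¬h (i , eq)) none
  hit-inj : Injective _≡_ _≡_ (proj₁ ∘ hit)
  hit-inj {i} {j} eq = injective (trans (sym (proj₂ (hit i))) (trans (cong e eq) (proj₂ (hit j))))

count-≟-positive : ∀ {M} (c : Fin M) → 1 ≤ count (λ d → does (c ≟ᶠ d))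
count-≟-positive c = count-positive _ c (dec-true (c ≟ᶠ c) refl)

count-pigeonhole : ∀ {n M} (P : Fin n → Bool) (code : Fin n → Fin M) t → M * t < count P →
  ∃[ c ] t < count (λ v → P v ∧ does (code v ≟ᶠ c))
count-pigeonhole {n} {M} P code t Mt<P =
  exceeds-average (λ c → count (λ v → P v ∧ does (code v ≟ᶠ c))) t (<-≤-trans Mt<P P≤)
  where
  pointwise : ∀ v → bit (P v) ≤ sum (λ c → bit (P v ∧ does (code v ≟ᶠ c)))
  pointwise v with P v
  ... | true  = count-≟-positive (code v)
  ... | false = z≤n
  P≤ : count P ≤ sum (λ c → count (λ v → P v ∧ does (code v ≟ᶠ c)))
  P≤ = ≤-trans (sum-mono pointwise) (≤-reflexive (∑-comm (λ v c → bit (P v ∧ does (code v ≟ᶠ c)))))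

∣tabulate∣≡count : ∀ {n} (P : Fin n → Bool) → ∣ tabulate P ∣ ≡ count P
∣tabulate∣≡count {zero}  P = refl
∣tabulate∣≡count {suc n} P with P zero
... | true  = cong suc (∣tabulate∣≡count (P ∘ suc))
... | false = ∣tabulate∣≡count (P ∘ suc)

-- The minimum-degree form of the Erdős–Stone theorem

-- Injectivity is asked only inside a part: vertices of different parts are adjacent and therefore
-- distinct. The set `W` confines the structure, so that it can later be found inside a common
-- neighbourhood.
record CompletePartite (G : Graph) (W : Vertex G → Bool) (k s : ℕ) : Set where
  field
    vertex    : Fin k → Fin s → Vertex G
    injective : ∀ i → Injective _≡_ _≡_ (vertex i)
    cross     : ∀ {i j} → i ≢ j → ∀ x y → Adj G (vertex i x) (vertex j y)
    inside    : ∀ i x → W (vertex i x) holds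

adj⇒≢ : ∀ G {u v} → Adj G u v → u ≢ v
adj⇒≢ G {u} uv refl = contradiction (trans (sym uv) (Graph.irrefl G u)) λ ()

adj-sym : ∀ G {u v} → Adj G u v → Adj G v u
adj-sym G {u} {v} uv = trans (Graph.symm G v u) uv

boolToFin : Bool → Fin 2
boolToFin true  = 0F
boolToFin false = 1F

boolToFin-injective : Injective _≡_ _≡_ boolToFin
boolToFin-injective {true}  {true}  _ = refl
boolToFin-injective {false} {false} _ = refl

funToFin-injective : ∀ {m n} (f g : Fin m → Fin n) → funToFin f ≡ funToFin g → ∀ i → f i ≡ g i
funToFin-injective f g eq i = trans (sym (finToFun-funToFin f i)) (trans (cong (λ c → finToFun c i) eq) (finToFun-funToFin g i))

module ErdősStoneStep {G : Graph} {W : Vertex G → Bool} {k s : ℕ} (A : CompletePartite G W k s) (t : ℕ) where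
  open CompletePartite A
  open Graph G using (adj)

  hits : Vertex G → Fin k → ℕ
  hits w i = count (λ x → adj w (vertex i x))

  misses : Vertex G → Fin k → ℕ
  misses w i = count (λ x → not (adj w (vertex i x)))

  rich? : ∀ w → Dec (∀ i → t ≤ hits w i)
  rich? w = all? (λ i → t ≤? hits w i)

  good bad : Vertex G → Bool
  good w = W w ∧ does (rich? w)
  bad  w = W w ∧ not (does (rich? w))

  bad-misses : ∀ w → (s ∸ t) * bit (bad w) ≤ sum (misses w)
  bad-misses w = refuted (W w) (rich? w) λ ¬rich → let i , hits<t = poor ¬rich in begin
    s ∸ t                              ≤⟨ ∸-monoʳ-≤ s (<⇒≤ hits<t) ⟩
    s ∸ hits w i                       ≡⟨ cong (_∸ hits w i) (sym (count-not (λ x → adj w (vertex i x)))) ⟩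
    hits w i + misses w i ∸ hits w i   ≡⟨ m+n∸m≡n (hits w i) _ ⟩
    misses w i                         ≤⟨ term≤sum (misses w) i ⟩
    sum (misses w)                     ∎
    where
    open ≤-Reasoning
    poor : ¬ (∀ i → t ≤ hits w i) → ∃[ i ] hits w i < t
    poor ¬rich = let i , t≰ = ¬∀⟶∃¬ k _ (λ i → t ≤? hits w i) ¬rich in i , ≰⇒> t≰
    refuted : ∀ {A : Set} {c d} b (a? : Dec A) → (¬ A → c ≤ d) → c * bit (b ∧ not (does a?)) ≤ d
    refuted {c = c} false _       _   = ≤-trans (≤-reflexive (*-zeroʳ c)) z≤n
    refuted {c = c} true  (yes _) _   = ≤-trans (≤-reflexive (*-zeroʳ c)) z≤n
    refuted {c = c} true  (no ¬a) c≤d = ≤-trans (≤-reflexive (*-identityʳ c)) (c≤d ¬a)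

  -- Double counting of non-adjacent pairs: a bad vertex misses at least `s ∸ t` vertices of some
  -- part, while each of the `k * s` vertices of the structure is missed by at most `c / q` vertices
  -- of the graph.
  bad-few : ∀ {q c} → (∀ v → q * count (not ∘ adj v) ≤ c) → q * ((s ∸ t) * count bad) ≤ k * (s * c)
  bad-few {q} {c} sparse = begin
    q * ((s ∸ t) * count bad)                              ≡⟨ cong (q *_) (*-distribˡ-sum (s ∸ t) (bit ∘ bad)) ⟩
    q * sum (λ w → (s ∸ t) * bit (bad w))                  ≤⟨ *-monoʳ-≤ q (sum-mono bad-misses) ⟩
    q * sum (λ w → sum (λ i → misses w i))                 ≡⟨ cong (q *_) (∑-comm misses) ⟩
    q * sum (λ i → sum (λ w → misses w i))                 ≡⟨ *-distribˡ-sum q (λ i → sum (λ w → misses w i)) ⟩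
    sum (λ i → q * sum (λ w → misses w i))                 ≤⟨ sum-≤-const (s * c) per-part ⟩
    k * (s * c)                                            ∎
    where
    open ≤-Reasoning
    per-part : ∀ i → q * sum (λ w → misses w i) ≤ s * c
    per-part i = begin
      q * sum (λ w → misses w i)                           ≡⟨ cong (q *_) (∑-comm (λ w x → bit (not (adj w (vertex i x))))) ⟩
      q * sum (λ x → sum (λ w → bit (not (adj w (vertex i x))))) ≡⟨ *-distribˡ-sum q (λ x → sum (λ w → bit (not (adj w (vertex i x))))) ⟩
      sum (λ x → q * sum (λ w → bit (not (adj w (vertex i x))))) ≤⟨ sum-≤-const c (λ x → ≤-trans (≤-reflexive (cong (q *_) (sum-cong-≗ (λ w → cong (bit ∘ not) (Graph.symm G w (vertex i x)))))) (sparse (vertex i x))) ⟩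
      s * c                                                ∎

  pattern-code : Vertex G → Fin ((2 ^ s) ^ k)
  pattern-code w = funToFin (λ i → funToFin (λ x → boolToFin (adj w (vertex i x))))

  pattern-code-adj : ∀ {v w} → pattern-code v ≡ pattern-code w → ∀ i x → adj v (vertex i x) ≡ adj w (vertex i x)
  pattern-code-adj eq i x = boolToFin-injective (funToFin-injective _ _ (funToFin-injective _ _ eq i) x)

  -- There are `(2 ^ s) ^ k` adjacency patterns towards the old parts, so more than `t` good
  -- vertices share one. They supply the new part; since a good vertex has at least `t` neighbours
  -- in every old part, the common pattern selects `t` vertices of each.
  extend : (2 ^ s) ^ k * t < count good → CompletePartite G W (suc k) t
  extend many = record { vertex = vertex′ ; injective = injective′ ; cross = cross′ ; inside = inside′ }
    where
    popular : ∃[ c ] t < count (λ v → good v ∧ does (pattern-code v ≟ᶠ c))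
    popular = count-pigeonhole good pattern-code t many
    c = proj₁ popular
    fibre : Vertex G → Bool
    fibre v = good v ∧ does (pattern-code v ≟ᶠ c)
    fibre-code : ∀ v → fibre v holds → pattern-code v ≡ c
    fibre-code v fv = does⇒ (pattern-code v ≟ᶠ c) (∧-holdsʳ {good v} fv)
    top = choose fibre (<⇒≤ (proj₂ popular))
    e = proj₁ top
    model : ∃[ v ] fibre v holds
    model = choose-one fibre (≤-trans (s≤s z≤n) (proj₂ popular))
    w = proj₁ model
    rich : ∀ i → t ≤ hits w i
    rich = does⇒ (rich? w) (∧-holdsʳ {W w} (∧-holdsˡ {good w} (proj₂ model)))
    sub : ∀ i → Σ[ e ∈ (Fin t → Fin s) ] (Injective _≡_ _≡_ e × (∀ x → adj w (vertex i (e x)) holds))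
    sub i = choose (λ x → adj w (vertex i x)) (rich i)
    vertex′ : Fin (suc k) → Fin t → Vertex G
    vertex′ zero    x = e x
    vertex′ (suc i) x = vertex i (proj₁ (sub i) x)
    top-adj : ∀ i x y → Adj G (e x) (vertex i (proj₁ (sub i) y))
    top-adj i x y = trans
      (pattern-code-adj (trans (fibre-code (e x) (proj₂ (proj₂ top) x)) (sym (fibre-code w (proj₂ model)))) i _)
      (proj₂ (proj₂ (sub i)) y)
    injective′ : ∀ i → Injective _≡_ _≡_ (vertex′ i)
    injective′ zero    = proj₁ (proj₂ top)
    injective′ (suc i) = proj₁ (proj₂ (sub i)) ∘ injective i
    cross′ : ∀ {i j} → i ≢ j → ∀ x y → Adj G (vertex′ i x) (vertex′ j y)
    cross′ {zero}  {zero}  i≢j x y = contradiction refl i≢j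
    cross′ {zero}  {suc j} i≢j x y = top-adj j x y
    cross′ {suc i} {zero}  i≢j x y = adj-sym G (top-adj i y x)
    cross′ {suc i} {suc j} i≢j x y = cross (i≢j ∘ cong suc) _ _
    inside′ : ∀ i x → W (vertex′ i x) holds
    inside′ zero    x = ∧-holdsˡ (∧-holdsˡ {good (e x)} (proj₂ (proj₂ top) x))
    inside′ (suc i) x = inside i _

-- In units of `n / q`, the set `W` has size at least `K b + 1` and its bad part at most
-- `K b (t + D) / D`, which leaves `1 - t K b / D` for the good part. With `D = t K b + 1` this is
-- `1 / D`, so there are at least `n / (q D)` good vertices.
erdős-stone-arithmetic : ∀ {n q K b t Wc g B M} → let D = suc (t * K * b) in
  suc (K * b) * n ≤ q * Wc → Wc ≡ g + B → q * (D * B) ≤ K * ((t + D) * (b * n)) → g ≤ M → n ≤ D * (q * M)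
erdős-stone-arithmetic {n} {q} {K} {b} {t} {Wc} {g} {B} {M} h₁ refl h₃ h₄ =
  +-cancelˡ-≤ (D * K * b * n + t * K * b * n) n _ (begin
    D * K * b * n + t * K * b * n + n           ≡⟨ e₁ n K b t D ⟩
    D * (K * b) * n + D * n                     ≡⟨ e₁′ n K b D ⟩
    D * (suc (K * b) * n)                       ≤⟨ *-monoʳ-≤ D h₁ ⟩
    D * (q * (g + B))                           ≡⟨ e₂ q g B D ⟩
    D * (q * g) + q * (D * B)                   ≤⟨ +-mono-≤ (*-monoʳ-≤ D (*-monoʳ-≤ q h₄)) h₃ ⟩
    D * (q * M) + K * ((t + D) * (b * n))       ≡⟨ e₃ n q K b t M D ⟩
    D * K * b * n + t * K * b * n + D * (q * M) ∎)
  where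
  open ≤-Reasoning
  D = suc (t * K * b)
  e₁ : ∀ n K b t D → D * K * b * n + t * K * b * n + n ≡ D * (K * b) * n + suc (t * K * b) * n
  e₁ = solve-∀
  e₁′ : ∀ n K b D → D * (K * b) * n + D * n ≡ D * (suc (K * b) * n)
  e₁′ = solve-∀
  e₂ : ∀ q g B D → D * (q * (g + B)) ≡ D * (q * g) + q * (D * B)
  e₂ = solve-∀
  e₃ : ∀ n q K b t M D → D * (q * M) + K * ((t + D) * (b * n)) ≡ D * K * b * n + t * K * b * n + D * (q * M)
  e₃ = solve-∀

-- A vertex has at most `b n / q` non-neighbours, itself included, so `k` vertices exclude at most
-- `k b n / q` vertices of `W` and the density hypothesis leaves a surplus of `n / q`. The induction
-- on `k` asks for larger parts, of size `t + D`, which `extend` trims to `t`.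
erdős-stone : ∀ q .{{_ : NonZero q}} b k t → ∃[ n₀ ] (∀ G W →
  (∀ v → q * count (not ∘ Graph.adj G v) ≤ b * order G) →
  suc (k * b) * order G ≤ q * count W →
  n₀ ≤ order G → CompletePartite G W (suc k) t)
erdős-stone q b zero t = q * t , λ G W sparse dense large →
  let e , e-inj , We = choose W (*-cancelˡ-≤ q (≤-trans large (≤-trans (≤-reflexive (sym (*-identityˡ (order G)))) dense)))
  in record
    { vertex    = const e
    ; injective = λ _ → e-inj
    ; cross     = λ { {0F} {0F} i≢j → contradiction refl i≢j }
    ; inside    = λ _ → We
    }
erdős-stone q b (suc k) t = n₀ ⊔ suc (D * (q * M)) , λ G W sparse dense large →
  let A = proj₂ previous G W sparse
        (≤-trans (*-monoˡ-≤ (order G) (s≤s (*-monoˡ-≤ b (n≤1+n k)))) dense)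
        (≤-trans (m≤m⊔n n₀ _) large)
      open ErdősStoneStep A t
      few : q * (D * count bad) ≤ suc k * ((t + D) * (b * order G))
      few = subst (λ d → q * (d * count bad) ≤ suc k * ((t + D) * (b * order G))) (m+n∸m≡n t D) (bad-few {q} sparse)
  in extend (≰⇒> λ good≤M → contradiction
       (erdős-stone-arithmetic {q = q} {K = suc k} {t = t} dense (count-split W _) few good≤M)
       (<⇒≱ (≤-trans (m≤n⊔m n₀ _) large)))
  where
  D = suc (t * suc k * b)
  M = (2 ^ (t + D)) ^ suc k * t
  previous = erdős-stone q b k (t + D)
  n₀ = proj₁ previous

-- Graphs of large girth and large chromatic number

-- The hypergraph with edges { anc ℓ j : j } abstracts the ancestors of the
-- leaves ℓ of a k-ary tree to which the leaves are joined; lab ℓ j is the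
-- branch that the path to ℓ takes at anc ℓ j, so descending along the colours
-- of f leads to a leaf as in `follow`.
record LabelledSystem (k r : ℕ) : Set where
  field
    leaves nodes  : ℕ
    anc           : Fin leaves → Fin r → Fin nodes
    lab           : Fin leaves → Fin r → Fin k
    anc-injective : ∀ ℓ → Injective _≡_ _≡_ (anc ℓ)
    follow        : ∀ (f : Fin nodes → Fin k) → ∃[ ℓ ] (∀ j → f (anc ℓ j) ≡ lab ℓ j)

  Shared : List (Fin leaves) → Fin leaves → Fin r → Set
  Shared Λ ℓ j = ∃[ m ] (m ∈ᴸ Λ × (m ≢ ℓ × ∃[ i ] anc m i ≡ anc ℓ j))

  shared? : ∀ Λ ℓ j → Dec (Shared Λ ℓ j)
  shared? Λ ℓ j = map′ find (λ (m , m∈Λ , p) → lose m∈Λ p)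
    (anyᴸ? (λ m → ¬? (m ≟ᶠ ℓ) ×-dec any? (λ i → anc m i ≟ᶠ anc ℓ j)) Λ)

  -- Any g edges span a hyperforest.  Excluding ℓ₀ is the strengthening that is
  -- inherited by compositions.
  Sparse : ℕ → Set
  Sparse g = ∀ Λ → length Λ ≤ g → ∀ ℓ₀ m → m ∈ᴸ Λ → m ≢ ℓ₀ →
    ∃[ ℓ ] (ℓ ∈ᴸ Λ × ℓ ≢ ℓ₀ × (∀ i j → Shared Λ ℓ i → Shared Λ ℓ j → i ≡ j))

SparseSystem : ℕ → ℕ → ℕ → Set
SparseSystem k r g = Σ[ S ∈ LabelledSystem k r ] LabelledSystem.Sparse S g

empty-system : ∀ k g → SparseSystem k 0 g
empty-system k g = record
  { leaves = 1 ; nodes = 0 ; anc = λ _ () ; lab = λ _ () ; anc-injective = λ { _ {()} } ; follow = λ f → zero , λ () }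
  , λ { Λ _ ℓ₀ m m∈Λ m≢ℓ₀ → m , m∈Λ , m≢ℓ₀ , λ () }

-- For `g = 0` only the empty list is tested, so all leaves may have the same `r` ancestors, one
-- leaf for each word of labels.
complete-system : ∀ k r → SparseSystem k r 0
complete-system k r = record
  { leaves = k ^ r ; nodes = r ; anc = λ _ j → j ; lab = finToFun ; anc-injective = λ _ eq → eq
  ; follow = λ f → funToFin f , λ j → sym (finToFun-funToFin f j) }
  , λ { [] _ _ _ () ; (_ ∷ _) () }

-- Hang a copy of S₁ below every leaf ℓ of S₂ and join the λ-th leaf of that
-- copy, in addition, to the λ-th ancestor of ℓ.  A cycle that leaves a copy uses
-- two leaves of it, so it projects to a cycle with fewer leaves in S₂.
module Composition {k r} (S₁ : LabelledSystem k r) (S₂ : LabelledSystem k (LabelledSystem.leaves S₁)) where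
  private
    module S₁ = LabelledSystem S₁
    module S₂ = LabelledSystem S₂

  Leaf : Set
  Leaf = Fin (S₂.leaves * S₁.leaves)

  upper : Leaf → Fin S₂.leaves
  upper = quotient {S₂.leaves} S₁.leaves

  lower : Leaf → Fin S₁.leaves
  lower = remainder {S₂.leaves} S₁.leaves

  leaf-≡ : ∀ {m n} → upper m ≡ upper n → lower m ≡ lower n → m ≡ n
  leaf-≡ {m} {n} eq₂ eq₁ = trans (sym (combine-remQuot {S₂.leaves} S₁.leaves m))
    (trans (cong₂ combine eq₂ eq₁) (combine-remQuot {S₂.leaves} S₁.leaves n))

  outer-node : Fin S₂.nodes → Fin (S₂.nodes + S₂.leaves * S₁.nodes)
  outer-node v = v ↑ˡ (S₂.leaves * S₁.nodes)

  inner-node : Fin S₂.leaves → Fin S₁.nodes → Fin (S₂.nodes + S₂.leaves * S₁.nodes)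
  inner-node ℓ v = S₂.nodes ↑ʳ combine ℓ v

  outer-node-injective : ∀ {u v} → outer-node u ≡ outer-node v → u ≡ v
  outer-node-injective = ↑ˡ-injective _ _ _

  inner-node-injective : ∀ {ℓ m u v} → inner-node ℓ u ≡ inner-node m v → ℓ ≡ m × u ≡ v
  inner-node-injective {ℓ} {m} {u} {v} eq = combine-injective ℓ u m v (↑ʳ-injective S₂.nodes _ _ eq)

  outer≢inner : ∀ {u ℓ v} → outer-node u ≢ inner-node ℓ v
  outer≢inner {u} {ℓ} {v} eq = contradiction
    (trans (sym (splitAt-↑ˡ S₂.nodes u _)) (trans (cong (splitAt S₂.nodes) eq) (splitAt-↑ʳ S₂.nodes _ (combine ℓ v))))
    λ ()

  anc : Leaf → Fin (suc r) → Fin (S₂.nodes + S₂.leaves * S₁.nodes)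
  anc m zero    = outer-node (S₂.anc (upper m) (lower m))
  anc m (suc j) = inner-node (upper m) (S₁.anc (lower m) j)

  lab : Leaf → Fin (suc r) → Fin k
  lab m zero    = S₂.lab (upper m) (lower m)
  lab m (suc j) = S₁.lab (lower m) j

  system : LabelledSystem k (suc r)
  system = record
    { leaves = S₂.leaves * S₁.leaves ; nodes = S₂.nodes + S₂.leaves * S₁.nodes ; anc = anc ; lab = lab
    ; anc-injective = anc-inj ; follow = follow }
    where
    anc-inj : ∀ m → Injective _≡_ _≡_ (anc m)
    anc-inj m {zero}  {zero}  _  = refl
    anc-inj m {zero}  {suc j} eq = contradiction eq outer≢inner
    anc-inj m {suc i} {zero}  eq = contradiction (sym eq) outer≢inner
    anc-inj m {suc i} {suc j} eq = cong suc (S₁.anc-injective _ (proj₂ (inner-node-injective eq)))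
    follow : ∀ f → ∃[ m ] (∀ j → f (anc m j) ≡ lab m j)
    follow f =
      let ℓ , outer = S₂.follow (f ∘ outer-node)
          l , inner = S₁.follow (f ∘ inner-node ℓ)
          eq = sym (remQuot-combine {S₂.leaves} ℓ l)
      in combine ℓ l , λ where
        zero    → subst (λ u → ∀ i → f (outer-node (S₂.anc u i)) ≡ S₂.lab u i) (cong proj₁ eq) outer _
        (suc j) → subst₂ (λ u d → ∀ i → f (inner-node u (S₁.anc d i)) ≡ S₁.lab d i) (cong proj₁ eq) (cong proj₂ eq) inner j

  open LabelledSystem system using (Shared; shared?)

  Sibling : Leaf → Leaf → Set
  Sibling m n = upper n ≡ upper m × n ≢ m

  sibling? : ∀ m n → Dec (Sibling m n)
  sibling? m n = (upper n ≟ᶠ upper m) ×-dec ¬? (n ≟ᶠ m)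

  -- A leaf outside the copy of `m₀` without a sibling in `Λ` can share only its extra ancestor, so
  -- it is pendant. If `Λ` lies inside the copy of `m₀`, no extra ancestor is shared and `S₁`
  -- decides. Otherwise every other copy that is met is met twice; dropping one leaf of such a pair
  -- loses no copy, so the projection to `S₂` has at most `g` entries. `S₂` then yields a copy in
  -- which at most one leaf shares its extra ancestor. With that leaf excluded, `S₁` yields a
  -- pendant leaf inside this copy.
  sparse : ∀ {g} → S₁.Sparse (suc g) → S₂.Sparse g → LabelledSystem.Sparse system (suc g)
  sparse {g} sparse₁ sparse₂ Λ len m₀ m₁ m₁∈Λ m₁≢m₀ =
    case anyᴸ? (λ m → ¬? (upper m ≟ᶠ upper m₀) ×-dec ¬? (anyᴸ? (sibling? m) Λ)) Λ of λ where
      (yes alone) → let m , m∈Λ , upper≢ , only = find alone in lonely m m∈Λ upper≢ only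
      (no  crowded) → case anyᴸ? (λ m → ¬? (upper m ≟ᶠ upper m₀)) Λ of λ where
        (no  same)  → concentrated (λ {m} m∈Λ → case upper m ≟ᶠ upper m₀ of λ where
                        (yes eq) → eq
                        (no ne)  → contradiction (lose m∈Λ ne) same)
        (yes other) → let m , m∈Λ , upper≢ = find other in spread (companion crowded) m m∈Λ upper≢
    where
    Goal : Set
    Goal = ∃[ ℓ ] (ℓ ∈ᴸ Λ × ℓ ≢ m₀ × (∀ i j → Shared Λ ℓ i → Shared Λ ℓ j → i ≡ j))

    inner-shared : ∀ {m j} → Shared Λ m (suc j) →
      ∃[ n ] (n ∈ᴸ Λ × n ≢ m × upper n ≡ upper m × ∃[ i ] S₁.anc (lower n) i ≡ S₁.anc (lower m) j)
    inner-shared (n , n∈Λ , n≢m , zero , eq)  = contradiction eq outer≢inner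
    inner-shared (n , n∈Λ , n≢m , suc i , eq) =
      let eq₂ , eq₁ = inner-node-injective eq in n , n∈Λ , n≢m , eq₂ , i , eq₁

    outer-shared : ∀ {m} → Shared Λ m zero →
      ∃[ n ] (n ∈ᴸ Λ × upper n ≢ upper m × S₂.anc (upper n) (lower n) ≡ S₂.anc (upper m) (lower m))
    outer-shared (n , n∈Λ , n≢m , suc i , eq) = contradiction (sym eq) outer≢inner
    outer-shared {m} (n , n∈Λ , n≢m , zero , eq) = n , n∈Λ , differ , eq′
      where
      eq′ = outer-node-injective eq
      differ : upper n ≢ upper m
      differ eq₂ = n≢m (leaf-≡ eq₂ (S₂.anc-injective (upper m) (trans (cong (λ ℓ → S₂.anc ℓ (lower n)) (sym eq₂)) eq′)))

    lonely : ∀ m → m ∈ᴸ Λ → upper m ≢ upper m₀ → ¬ Any (Sibling m) Λ → Goal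
    lonely m m∈Λ upper≢ only = m , m∈Λ , upper≢ ∘ cong upper , λ i j si sj → trans (is-zero i si) (sym (is-zero j sj))
      where
      is-zero : ∀ j → Shared Λ m j → j ≡ zero
      is-zero zero    _ = refl
      is-zero (suc j) s = let n , n∈Λ , n≢m , eq , _ = inner-shared s in contradiction (lose n∈Λ (eq , n≢m)) only

    -- Inside one copy of S₁, a pendant leaf other than `excluded` whose extra
    -- edge is not shared is pendant in the composition.
    inside-copy : ∀ ℓ (excluded : Leaf) → upper excluded ≡ ℓ → ∀ n → n ∈ᴸ Λ → upper n ≡ ℓ → n ≢ excluded →
      (∀ {m} → m ∈ᴸ Λ → upper m ≡ ℓ → m ≢ excluded → ¬ Shared Λ m zero × m ≢ m₀) → Goal
    inside-copy ℓ x x-up n n∈Λ n-up n≢x unshared = conclude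
      (sparse₁ Λ₁ (≤-trans (≤-reflexive (length-map lower Λℓ)) (≤-trans (length-filter _ Λ) len)) (lower x) (lower n)
        (∈-map⁺ lower (∈-filter⁺ in-copy? n∈Λ n-up)) (λ eq → n≢x (leaf-≡ (trans n-up (sym x-up)) eq)))
      where
      in-copy? : ∀ m → Dec (upper m ≡ ℓ)
      in-copy? m = upper m ≟ᶠ ℓ
      Λℓ = filter in-copy? Λ
      Λ₁ = map lower Λℓ
      conclude : ∃[ l ] (l ∈ᴸ Λ₁ × l ≢ lower x × (∀ i j → S₁.Shared Λ₁ l i → S₁.Shared Λ₁ l j → i ≡ j)) → Goal
      conclude (l , l∈Λ₁ , l≢ , pendant) with ∈-map⁻ lower l∈Λ₁
      ... | m , m∈Λℓ , refl with ∈-filter⁻ in-copy? {xs = Λ} m∈Λℓ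
      ...   | m∈Λ , refl = m , m∈Λ , proj₂ (unshared m∈Λ refl m≢x) , unique
        where
        m≢x : m ≢ x
        m≢x eq = l≢ (cong lower eq)
        descend : ∀ {j} → Shared Λ m (suc j) → S₁.Shared Λ₁ (lower m) j
        descend s = let n′ , n′∈Λ , n′≢m , eq , i , anc-eq = inner-shared s in
          lower n′ , ∈-map⁺ lower (∈-filter⁺ in-copy? n′∈Λ eq) , (λ low → n′≢m (leaf-≡ eq low)) , i , anc-eq
        unique : ∀ i j → Shared Λ m i → Shared Λ m j → i ≡ j
        unique zero    _       si _  = contradiction si (proj₁ (unshared m∈Λ refl m≢x))
        unique (suc _) zero    _  sj = contradiction sj (proj₁ (unshared m∈Λ refl m≢x))
        unique (suc i) (suc j) si sj = cong suc (pendant i j (descend si) (descend sj))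

    concentrated : (∀ {m} → m ∈ᴸ Λ → upper m ≡ upper m₀) → Goal
    concentrated same = inside-copy (upper m₀) m₀ refl m₁ m₁∈Λ (same m₁∈Λ) m₁≢m₀
      λ m∈Λ eq m≢m₀ → (λ s → let n , n∈Λ , ne , _ = outer-shared s in ne (trans (same n∈Λ) (sym eq))) , m≢m₀

    Companion : Set
    Companion = ∀ {m} → m ∈ᴸ Λ → upper m ≢ upper m₀ → ∃[ n ] (n ∈ᴸ Λ × Sibling m n)

    companion : ¬ Any (λ m → upper m ≢ upper m₀ × ¬ Any (Sibling m) Λ) Λ → Companion
    companion crowded {m} m∈Λ upper≢ = case anyᴸ? (sibling? m) Λ of λ where
      (yes p) → find p
      (no ¬p) → contradiction (lose m∈Λ (upper≢ , ¬p)) crowded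

    spread : Companion → ∀ m → m ∈ᴸ Λ → upper m ≢ upper m₀ → Goal
    spread comp m₂ m₂∈Λ upper≢ with comp m₂∈Λ upper≢
    ... | m₃ , m₃∈Λ , up₃ , m₃≢m₂ with ∈-∃++ m₃∈Λ
    ...   | xs , ys , refl = conclude (sparse₂ Π (≤-trans (≤-reflexive (length-map upper (xs ++ ys))) shorter)
                              (upper m₀) (upper m₂) (covers m₂∈Λ) upper≢)
      where
      Π = map upper (xs ++ ys)
      shorter : length (xs ++ ys) ≤ g
      shorter = ≤-pred (≤-trans (≤-reflexive (trans (cong suc (length-++ xs))
        (trans (sym (+-suc (length xs) (length ys))) (sym (length-++ xs))))) len)
      others : ∀ {m} → m ∈ᴸ xs ++ m₃ ∷ ys → m ≢ m₃ → m ∈ᴸ xs ++ ys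
      others m∈Λ m≢m₃ with ∈-++⁻ xs m∈Λ
      ... | inj₁ m∈xs         = ∈-++⁺ˡ m∈xs
      ... | inj₂ (here eq)    = contradiction eq m≢m₃
      ... | inj₂ (there m∈ys) = ∈-++⁺ʳ xs m∈ys
      covers : ∀ {m} → m ∈ᴸ Λ → upper m ∈ᴸ Π
      covers {m} m∈Λ with m ≟ᶠ m₃
      ... | yes refl = subst (_∈ᴸ Π) (sym up₃) (∈-map⁺ upper (others m₂∈Λ (λ eq → m₃≢m₂ (sym eq))))
      ... | no ne    = ∈-map⁺ upper (others m∈Λ ne)
      survives : ∀ {m} → m ∈ᴸ xs ++ ys → m ∈ᴸ Λ
      survives m∈ with ∈-++⁻ xs m∈
      ... | inj₁ m∈xs = ∈-++⁺ˡ m∈xs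
      ... | inj₂ m∈ys = ∈-++⁺ʳ xs (there m∈ys)
      shared₂ : ∀ {m} → Shared Λ m zero → S₂.Shared Π (upper m) (lower m)
      shared₂ s = let n , n∈Λ , ne , eq = outer-shared s in upper n , covers n∈Λ , ne , lower n , eq
      conclude : ∃[ ℓ ] (ℓ ∈ᴸ Π × ℓ ≢ upper m₀ × (∀ i j → S₂.Shared Π ℓ i → S₂.Shared Π ℓ j → i ≡ j)) → Goal
      conclude (ℓ , ℓ∈Π , ℓ≢ , pendant) with ∈-map⁻ upper ℓ∈Π
      ... | m₄ , m₄∈ , refl = pick (anyᴸ? (λ m → (upper m ≟ᶠ upper m₄) ×-dec shared? Λ m zero) Λ)
        where
        m₄∈Λ = survives m₄∈
        avoids : ∀ {m} → upper m ≡ upper m₄ → m ≢ m₀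
        avoids eq m≡m₀ = ℓ≢ (trans (sym eq) (cong upper m≡m₀))
        pick : Dec (Any (λ m → upper m ≡ upper m₄ × Shared Λ m zero) Λ) → Goal
        -- No extra ancestor is shared in this copy, so the excluded leaf is arbitrary.
        pick (no none) = let m₅ , m₅∈Λ , up₅ , m₅≢m₄ = comp m₄∈Λ ℓ≢ in
          inside-copy (upper m₄) m₄ refl m₅ m₅∈Λ up₅ m₅≢m₄
            λ m∈Λ eq _ → (λ s → none (lose m∈Λ (eq , s))) , avoids eq
        pick (yes some) =
          let x , x∈Λ , x-up , x-shared = find some
              m₅ , m₅∈Λ , up₅ , m₅≢x = comp x∈Λ (λ eq → ℓ≢ (trans (sym x-up) eq))
              at-ℓ : ∀ {m} → upper m ≡ upper m₄ → Shared Λ m zero → S₂.Shared Π (upper m₄) (lower m)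
              at-ℓ {m} eq s = subst (λ ℓ → S₂.Shared Π ℓ (lower m)) eq (shared₂ s)
          in inside-copy (upper m₄) x x-up m₅ m₅∈Λ (trans up₅ x-up) m₅≢x
            λ m∈Λ eq m≢x → (λ s → m≢x (leaf-≡ (trans eq (sym x-up)) (pendant _ _ (at-ℓ eq s) (at-ℓ x-up x-shared)))) , avoids eq

-- Lexicographic recursion on `g` and `r`. The upper system has as many ancestors per leaf as the
-- lower one has leaves, but it is needed only for lists that are shorter by one.
sparse-system : ∀ k g r → SparseSystem k r g
sparse-system k zero    r       = complete-system k r
sparse-system k (suc g) zero    = empty-system k (suc g)
sparse-system k (suc g) (suc r) =
  let S₁ , sparse₁ = sparse-system k (suc g) r
      S₂ , sparse₂ = sparse-system k g (LabelledSystem.leaves S₁)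
      open Composition S₁ S₂
  in system , sparse sparse₁ sparse₂

-- Cyclic indices, girth, and the graph obtained from a sparse system.

next : ∀ {n} → Fin (suc n) → Fin (suc n)
next i with view i
... | ‵fromℕ         = zero
... | ‵inj₁ {i = j} _ = suc j

next-fromℕ : ∀ n → next (fromℕ n) ≡ zero
next-fromℕ n rewrite view-fromℕ n = refl

next-inject₁ : ∀ {n} (j : Fin n) → next (inject₁ j) ≡ suc j
next-inject₁ j rewrite view-inject₁ j = refl

next-surjective : ∀ {n} (i : Fin (suc n)) → ∃[ p ] next p ≡ i
next-surjective zero    = fromℕ _ , next-fromℕ _
next-surjective (suc j) = inject₁ j , next-inject₁ j

toℕ-next : ∀ {n} (i : Fin (suc n)) →
  (toℕ i ≡ n × next i ≡ zero) ⊎ toℕ (next i) ≡ suc (toℕ i)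
toℕ-next i with view i
... | ‵fromℕ {n}      = inj₁ (toℕ-fromℕ n , refl)
... | ‵inj₁ {i = j} _ = inj₂ (cong suc (sym (toℕ-inject₁ j)))

next≢ : ∀ {n} (i : Fin (suc (suc n))) → next i ≢ i
next≢ i eq with toℕ-next i
... | inj₁ (top , zeroed) = contradiction (trans (sym top) (cong toℕ (trans (sym eq) zeroed))) λ ()
... | inj₂ up = 1+n≢n (trans (sym up) (cong toℕ eq))

next²≢ : ∀ {n} (i : Fin (suc (suc (suc n)))) → next (next i) ≢ i
next²≢ {n} i eq with toℕ-next i | toℕ-next (next i)
... | inj₁ (top , zeroed) | inj₁ (top′ , _) = contradiction (trans (sym top′) (cong toℕ zeroed)) λ ()
... | inj₁ (top , zeroed) | inj₂ up = contradiction
      (trans (sym top) (trans (cong toℕ (sym eq)) (trans up (cong (suc ∘ toℕ) zeroed)))) λ ()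
... | inj₂ up | inj₁ (top , zeroed) = contradiction
      (trans (sym top) (trans up (cong suc (cong toℕ (trans (sym eq) zeroed))))) λ ()
... | inj₂ up | inj₂ up′ = m≢1+n+m (toℕ i) {1} (trans (cong toℕ (sym eq)) (trans up′ (cong suc up)))

-- Cyclic indexing removes the special role of the closing edge, so that every edge has a
-- predecessor and a successor.
cycle-edge : ∀ {G m} (C : Cycle G m) i → Adj G (Cycle.vertex C i) (Cycle.vertex C (next i))
cycle-edge C i with view i
... | ‵fromℕ          = Cycle.close C
... | ‵inj₁ {i = j} _ = Cycle.step C j

GirthAbove : ℕ → Graph → Set
GirthAbove g G = ∀ m → 3 + m ≤ g → ¬ Cycle G m

module LeafGraph {k g} (S : LabelledSystem k (suc k)) (sparse : LabelledSystem.Sparse S g) where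
  open LabelledSystem S

  -- With `k + 1` ancestors and `k` labels, each leaf repeats a label; its edge joins the two
  -- ancestors concerned. Following a `k`-colouring leads to a leaf each of whose ancestors has its
  -- label as colour, so the edge of that leaf is monochromatic.
  repetition : ∀ ℓ → ∃[ i ] ∃[ j ] (i ≢ j × lab ℓ i ≡ lab ℓ j)
  repetition ℓ = let i , j , i<j , eq = pigeonhole (n<1+n k) (lab ℓ) in i , j , <⇒≢ i<j , eq

  end₁ end₂ : Fin leaves → Fin nodes
  end₁ ℓ = anc ℓ (proj₁ (repetition ℓ))
  end₂ ℓ = anc ℓ (proj₁ (proj₂ (repetition ℓ)))

  end₁≢end₂ : ∀ ℓ → end₁ ℓ ≢ end₂ ℓ
  end₁≢end₂ ℓ eq = proj₁ (proj₂ (proj₂ (repetition ℓ))) (anc-injective ℓ eq)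

  Joins : Fin leaves → Fin nodes → Fin nodes → Set
  Joins ℓ u v = (end₁ ℓ ≡ u × end₂ ℓ ≡ v) ⊎ (end₁ ℓ ≡ v × end₂ ℓ ≡ u)

  joins? : ∀ u v ℓ → Dec (Joins ℓ u v)
  joins? u v ℓ = ((end₁ ℓ ≟ᶠ u) ×-dec (end₂ ℓ ≟ᶠ v)) ⊎-dec ((end₁ ℓ ≟ᶠ v) ×-dec (end₂ ℓ ≟ᶠ u))

  joins-sym : ∀ {ℓ u v} → Joins ℓ u v → Joins ℓ v u
  joins-sym = [ inj₂ , inj₁ ]′

  joins-consecutive : ∀ {ℓ u v w} → Joins ℓ u v → Joins ℓ v w → u ≡ v ⊎ u ≡ w
  joins-consecutive (inj₁ (refl , refl)) (inj₁ (eq , _)) = inj₁ eq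
  joins-consecutive (inj₁ (refl , refl)) (inj₂ (eq , _)) = inj₂ eq
  joins-consecutive (inj₂ (refl , refl)) (inj₁ (_ , eq)) = inj₂ eq
  joins-consecutive (inj₂ (refl , refl)) (inj₂ (_ , eq)) = inj₁ eq

  joins-anc : ∀ {ℓ u v} → Joins ℓ u v → ∃[ j ] anc ℓ j ≡ u
  joins-anc (inj₁ (eq , _)) = _ , eq
  joins-anc (inj₂ (_ , eq)) = _ , eq

  graph : Graph
  graph = record
    { order  = nodes
    ; adj    = λ u v → does (any? (joins? u v))
    ; symm   = λ u v → does-⇔ (mk⇔ (λ (ℓ , J) → ℓ , joins-sym J) (λ (ℓ , J) → ℓ , joins-sym J)) (any? (joins? u v)) (any? (joins? v u))
    ; irrefl = λ v → dec-false (any? (joins? v v)) λ where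
        (ℓ , inj₁ (eq , eq′)) → end₁≢end₂ ℓ (trans eq (sym eq′))
        (ℓ , inj₂ (eq , eq′)) → end₁≢end₂ ℓ (trans eq (sym eq′))
    }

  not-colourable : ¬ Colourable graph k
  not-colourable (c , proper) =
    let ℓ , match = follow c
        i , j , _ , same = repetition ℓ
    in proper (end₁ ℓ) (end₂ ℓ) (dec-true (any? (joins? _ _)) (ℓ , inj₁ (refl , refl)))
         (trans (match i) (trans same (sym (match j))))

  -- Consecutive edges of a cycle come from different leaves, which share the ancestor at the common
  -- vertex. Hence each leaf of the list shares both ends of its edge, two different ancestors, and
  -- none is pendant.
  girth-above : GirthAbove g graph
  girth-above m short C = pendant-on-cycle
    (sparse Λ (≤-trans (≤-reflexive (length-tabulate ℓ)) short) (ℓ zero) (ℓ (next zero)) (∈-tabulate⁺ {f = ℓ} (next zero)) (ℓ-next≢ zero))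
    where
    open Cycle C
    leaf : ∀ i → ∃[ ℓ ] Joins ℓ (vertex i) (vertex (next i))
    leaf i = does⇒ (any? (joins? (vertex i) (vertex (next i)))) (cycle-edge C i)
    ℓ : Fin (3 + m) → Fin leaves
    ℓ = proj₁ ∘ leaf
    Λ = tabulateᴸ ℓ
    ℓ-next≢ : ∀ i → ℓ (next i) ≢ ℓ i
    ℓ-next≢ i eq with joins-consecutive (proj₂ (leaf i)) (subst (λ l → Joins l _ _) eq (proj₂ (leaf (next i))))
    ... | inj₁ same = next≢ i (injective (sym same))
    ... | inj₂ same = next²≢ i (injective (sym same))
    pendant-on-cycle : ¬ (∃[ l ] (l ∈ᴸ Λ × l ≢ ℓ zero × (∀ a b → Shared Λ l a → Shared Λ l b → a ≡ b)))
    pendant-on-cycle (l , l∈Λ , _ , pendant) with ∈-tabulate⁻ {f = ℓ} l∈Λ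
    ... | i , refl with next-surjective i
    ...   | p , refl = next≢ i (injective (trans (sym b-eq) (trans (cong (anc (ℓ i)) b≡a) a-eq)))
      where
      a-spec = joins-anc (proj₂ (leaf i))
      b-spec = joins-anc (joins-sym (proj₂ (leaf i)))
      a-eq = proj₂ a-spec
      b-eq = proj₂ b-spec
      b≡a : proj₁ b-spec ≡ proj₁ a-spec
      b≡a = pendant _ _
        (let b′ , eq = joins-anc (proj₂ (leaf (next i))) in
          ℓ (next i) , ∈-tabulate⁺ {f = ℓ} (next i) , ℓ-next≢ i , b′ , trans eq (sym b-eq))
        (let a′ , eq = joins-anc (joins-sym (proj₂ (leaf p))) in
          ℓ p , ∈-tabulate⁺ {f = ℓ} p , (λ e → ℓ-next≢ p (sym e)) , a′ , trans eq (sym a-eq))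

large-girth-large-chromatic-number : ∀ k g → Σ[ G ∈ Graph ] (¬ Colourable G k × GirthAbove g G)
large-girth-large-chromatic-number k g =
  let S , sparse = sparse-system k g (suc k)
      open LeafGraph S sparse
  in graph , not-colourable , girth-above

-- Degeneracy and forests

neighbours-in : (G : Graph) → (Vertex G → Bool) → Vertex G → ℕ
neighbours-in G X v = count (λ w → X w ∧ Graph.adj G v w)

record Core (G : Graph) (X : Vertex G → Bool) (D : ℕ) : Set where
  field
    core     : Vertex G → Bool
    core⊆    : ∀ v → core v holds → X v holds
    root     : Vertex G
    root∈    : core root holds
    degrees  : ∀ v → core v holds → D ≤ neighbours-in G core v

ColourableOn : (G : Graph) → (Vertex G → Bool) → ℕ → Set
ColourableOn G X k = Σ[ c ∈ (Vertex G → Fin k) ] (∀ u v → X u holds → X v holds → Adj G u v → c u ≢ c v)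

remove : ∀ {n} → Fin n → (Fin n → Bool) → Fin n → Bool
remove v X w = X w ∧ not (does (w ≟ᶠ v))

remove-holds : ∀ {n} {v w : Fin n} {X : Fin n → Bool} → X w holds → w ≢ v → remove v X w holds
remove-holds {v = v} {w} Xw w≢v = ∧-holds Xw (cong not (dec-false (w ≟ᶠ v) w≢v))

count-remove : ∀ {n} {v : Fin n} {X : Fin n → Bool} → X v holds → count (remove v X) < count X
count-remove {v = v} {X} Xv = <-≤-trans
  (m<n+m (count (remove v X)) (count-positive (λ w → X w ∧ does (w ≟ᶠ v)) v (∧-holds Xv (dec-true (v ≟ᶠ v) refl))))
  (≤-reflexive (sym (count-split X (λ w → does (w ≟ᶠ v)))))

update : ∀ {n} {A : Set} → (Fin n → A) → Fin n → A → Fin n → A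
update f v a w = if does (w ≟ᶠ v) then a else f w

-- Vertices with at most `D` remaining neighbours are deleted one at a time. If this gets stuck on a
-- nonempty set, that set is the core; otherwise the vertices are coloured in reverse order of
-- deletion, each having at most `D` colours to avoid.
degenerate-or-core : ∀ G X D → ColourableOn G X (suc D) ⊎ Core G X (suc D)
degenerate-or-core G X D = go (count X) X ≤-refl (λ _ Xv → Xv)
  where
  open Graph G using (adj)
  go : ∀ fuel Y → count Y ≤ fuel → (∀ v → Y v holds → X v holds) → ColourableOn G Y (suc D) ⊎ Core G X (suc D)
  go fuel Y small Y⊆X with any? (λ v → (Y v ≟ᵇ true) ×-dec (neighbours-in G Y v <? suc D))
  ... | no none = case any? (λ v → Y v ≟ᵇ true) of λ where
    (yes (v , Yv)) → inj₂ record
      { core = Y ; core⊆ = Y⊆X ; root = v ; root∈ = Yv ; degrees = λ w Yw → ≮⇒≥ (λ lt → none (w , Yw , lt)) }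
    (no empty) → inj₁ (const zero , λ u _ Yu → contradiction (u , Yu) empty)
  go zero Y small Y⊆X | yes (v , Yv , _) = contradiction small (<⇒≱ (count-positive Y v Yv))
  go (suc fuel) Y small Y⊆X | yes (v , Yv , few)
    with go fuel (remove v Y) (≤-pred (≤-trans (count-remove {X = Y} Yv) small)) (λ w → Y⊆X w ∘ ∧-holdsˡ)
  ... | inj₂ core = inj₂ core
  ... | inj₁ (c , proper) = inj₁ (update c v colour , proper′)
    where
    open Enumeration (enumerate (λ w → Y w ∧ adj v w))
    unused = fresh (const true) (c ∘ element) (<-≤-trans few (≤-reflexive (sym (count-const-true (suc D)))))
    colour = proj₁ unused
    colour-avoids : ∀ w → Y w holds → Adj G v w → c w ≢ colour
    colour-avoids w Yw vw eq = let i , i≡w = complete w (∧-holds Yw vw) in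
      proj₂ (proj₂ unused) i (trans (cong c i≡w) eq)
    proper′ : ∀ u w → Y u holds → Y w holds → Adj G u w → update c v colour u ≢ update c v colour w
    proper′ u w Yu Yw uw with u ≟ᶠ v | w ≟ᶠ v
    ... | yes refl | yes refl = contradiction refl (adj⇒≢ G uw)
    ... | yes refl | no _     = λ eq → colour-avoids w Yw uw (sym eq)
    ... | no _     | yes refl = colour-avoids u Yu (adj-sym G uw)
    ... | no u≢v   | no w≢v   = proper u w (remove-holds {X = Y} Yu u≢v) (remove-holds {X = Y} Yw w≢v) uw

record Path (G : Graph) (X : Vertex G → Bool) (l : ℕ) : Set where
  field
    vertex    : Fin (suc (suc l)) → Vertex G
    injective : Injective _≡_ _≡_ vertex
    step      : ∀ i → Adj G (vertex (inject₁ i)) (vertex (suc i))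
    inside    : ∀ i → X (vertex i) holds

cons-path : ∀ {G X l} (p : Path G X l) u → X u holds → Adj G u (Path.vertex p zero) →
  (∀ i → Path.vertex p i ≢ u) → Path G X (suc l)
cons-path {G} {X} {l} p u Xu u~ new = record { vertex = vertex′ ; injective = injective′ ; step = step′ ; inside = inside′ }
  where
  open Path p
  vertex′ : Fin (suc (suc (suc l))) → Vertex G
  vertex′ zero    = u
  vertex′ (suc i) = vertex i
  injective′ : Injective _≡_ _≡_ vertex′
  injective′ {zero}  {zero}  _  = refl
  injective′ {zero}  {suc j} eq = contradiction (sym eq) (new j)
  injective′ {suc i} {zero}  eq = contradiction eq (new i)
  injective′ {suc i} {suc j} eq = cong suc (injective eq)
  step′ : ∀ i → Adj G (vertex′ (inject₁ i)) (vertex′ (suc i))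
  step′ zero    = u~
  step′ (suc i) = step i
  inside′ : ∀ i → X (vertex′ i) holds
  inside′ zero    = Xu
  inside′ (suc i) = inside i

close-path : ∀ {G X l} (p : Path G X l) (i : Fin l) → Adj G (Path.vertex p zero) (Path.vertex p (suc (suc i))) →
  Cycle G (toℕ i)
close-path {G} {X} {l} p i chord = record
  { vertex    = λ j → vertex (inject≤ j le)
  ; injective = λ eq → inject≤-injective le le _ _ (injective eq)
  ; step      = λ j → subst (λ a → Adj G (vertex a) (vertex (suc (inject≤ j (≤-pred le))))) (restrict j) (step (inject≤ j (≤-pred le)))
  ; close     = subst (λ a → Adj G (vertex a) (vertex zero)) (sym top) (adj-sym G chord)
  }
  where
  open Path p
  le : suc (suc (suc (toℕ i))) ≤ suc (suc l)
  le = s≤s (s≤s (toℕ<n i))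
  restrict : ∀ j → inject₁ (inject≤ j (≤-pred le)) ≡ inject≤ (inject₁ j) le
  restrict j = toℕ-injective (trans (toℕ-inject₁ _) (trans (toℕ-inject≤ j _)
    (trans (sym (toℕ-inject₁ j)) (sym (toℕ-inject≤ (inject₁ j) le)))))
  top : inject≤ (fromℕ (suc (suc (toℕ i)))) le ≡ suc (suc i)
  top = toℕ-injective (trans (toℕ-inject≤ _ le) (toℕ-fromℕ _))

-- A path is prolonged at its first vertex: a core neighbour of it other than the second vertex is
-- either new or a later vertex of the path, and then closes a cycle. The path has `l + 2` vertices,
-- so the fuel cannot run out before a cycle appears.
core-has-cycle : ∀ {G X} → Core G X 2 → ∃[ m ] Cycle G m
core-has-cycle {G} {X} C = extend (order G) 0 start ≤-refl
  where
  open Core C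
  open Graph G using (adj)
  avoid : ∀ v → core v holds → ∀ w → ∃[ u ] ((core u ∧ adj v u) holds × (∀ (i : Fin 1) → w ≢ u))
  avoid v Cv w = fresh (λ u → core u ∧ adj v u) (const w) (degrees v Cv)
  extend : ∀ fuel l → Path G core l → order G ≤ l + fuel → ∃[ m ] Cycle G m
  extend zero l p full = contradiction
    (≤-trans (injective⇒≤ (Path.injective p)) (≤-trans full (≤-reflexive (+-identityʳ l)))) (<⇒≱ (n≤1+n (suc l)))
  extend (suc fuel) l p full = decide (any? (λ i → vertex i ≟ᶠ u))
    where
    open Path p
    found = avoid (vertex 0F) (inside 0F) (vertex 1F)
    u = proj₁ found
    u∈core = ∧-holdsˡ {core u} (proj₁ (proj₂ found))
    chord : Adj G (vertex 0F) u
    chord = ∧-holdsʳ {core u} (proj₁ (proj₂ found))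
    decide : Dec (∃[ i ] vertex i ≡ u) → ∃[ m ] Cycle G m
    decide (no new) = extend fuel (suc l) (cons-path p u u∈core (adj-sym G chord) (λ i eq → new (i , eq)))
      (≤-trans full (≤-reflexive (+-suc l fuel)))
    decide (yes (zero , eq))        = contradiction eq (adj⇒≢ G chord)
    decide (yes (suc zero , eq))    = contradiction eq (proj₂ (proj₂ found) 0F)
    decide (yes (suc (suc i) , eq)) = toℕ i , close-path p i (subst (Adj G (vertex 0F)) (sym eq) chord)
  start : Path G core 0
  start = record
    { vertex    = ends
    ; injective = ends-injective
    ; step      = λ { 0F → adj-sym G root~ }
    ; inside    = λ { 0F → ∧-holdsˡ {core (proj₁ found)} (proj₁ (proj₂ found)) ; 1F → root∈ }
    }
    where
    found = avoid root root∈ root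
    root~ : Adj G root (proj₁ found)
    root~ = ∧-holdsʳ {core (proj₁ found)} (proj₁ (proj₂ found))
    ends : Fin 2 → Vertex G
    ends 0F = proj₁ found
    ends 1F = root
    ends-injective : Injective _≡_ _≡_ ends
    ends-injective {0F} {0F} _  = refl
    ends-injective {0F} {1F} eq = contradiction (sym eq) (adj⇒≢ G root~)
    ends-injective {1F} {0F} eq = contradiction eq (adj⇒≢ G root~)
    ends-injective {1F} {1F} _  = refl

forest-2-colourable : ∀ {F} → Forest F → Colourable F 2
forest-2-colourable {F} forest with degenerate-or-core F (const true) 1
... | inj₁ (c , proper) = c , λ u v → proper u v refl refl
... | inj₂ core = let m , C = core-has-cycle core in contradiction C (forest m)

count<2⇒unique : ∀ {n} (P : Fin n → Bool) {a b} → count P < 2 → P a holds → P b holds → a ≡ b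
count<2⇒unique P {a} {b} few Pa Pb with a ≟ᶠ b
... | yes eq = eq
... | no a≢b = contradiction (injection⇒≤count P pair pair-injective pair-holds) (<⇒≱ few)
  where
  pair : Fin 2 → _
  pair 0F = a
  pair 1F = b
  pair-injective : Injective _≡_ _≡_ pair
  pair-injective {0F} {0F} _  = refl
  pair-injective {0F} {1F} eq = contradiction eq a≢b
  pair-injective {1F} {0F} eq = contradiction (sym eq) a≢b
  pair-injective {1F} {1F} _  = refl
  pair-holds : ∀ i → P (pair i) holds
  pair-holds 0F = Pa
  pair-holds 1F = Pb

module ForestEmbedding {F G : Graph} {X : Vertex G → Bool} (forest : Forest F) (C : Core G X (suc (order F))) where
  open Core C

  -- `to` is total, with arbitrary core vertices as values outside `Y`. A new vertex is chosen off
  -- all `order F` values, the arbitrary ones included, which is where the degree `order F + 1` of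
  -- the core comes from.
  record PartialEmbedding (Y : Vertex F → Bool) : Set where
    field
      to        : Vertex F → Vertex G
      injective : ∀ u v → Y u holds → Y v holds → to u ≡ to v → u ≡ v
      preserves : ∀ u v → Y u holds → Y v holds → Adj F u v → Adj G (to u) (to v)
      inside    : ∀ u → core (to u) holds

  add-leaf : ∀ Y v → Y v holds → neighbours-in F Y v < 2 → PartialEmbedding (remove v Y) → PartialEmbedding Y
  add-leaf Y v Yv few E = record
    { to = to′ ; injective = injective′ ; preserves = preserves′ ; inside = inside′ }
    where
    open PartialEmbedding E
    base : ∃[ y ] (core y holds × (∀ w → Y w holds → Adj F v w → to w ≡ y))
    base with any? (λ w → (Y w ∧ Graph.adj F v w) ≟ᵇ true)
    ... | yes (p , p~v) = to p , inside p , λ w Yw vw →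
      cong to (count<2⇒unique (λ w → Y w ∧ Graph.adj F v w) few (∧-holds Yw vw) p~v)
    -- Without a neighbour to attach to, any core vertex serves as base.
    ... | no none = root , root∈ , λ w Yw vw → contradiction (w , ∧-holds Yw vw) none
    y = proj₁ base
    new = fresh (λ x → core x ∧ Graph.adj G y x) to (degrees y (proj₁ (proj₂ base)))
    x = proj₁ new
    x~y : Adj G y x
    x~y = ∧-holdsʳ {core x} (proj₁ (proj₂ new))
    to′ = update to v x
    attached : ∀ w → Y w holds → Adj F v w → Adj G (to w) x
    attached w Yw vw = subst (λ a → Adj G a x) (sym (proj₂ (proj₂ base) w Yw vw)) x~y
    injective′ : ∀ u w → Y u holds → Y w holds → to′ u ≡ to′ w → u ≡ w
    injective′ u w Yu Yw with u ≟ᶠ v | w ≟ᶠ v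
    ... | yes refl | yes refl = λ _ → refl
    ... | yes refl | no _     = λ eq → contradiction (sym eq) (proj₂ (proj₂ new) w)
    ... | no _     | yes refl = λ eq → contradiction eq (proj₂ (proj₂ new) u)
    ... | no u≢v   | no w≢v   = injective u w (remove-holds {X = Y} Yu u≢v) (remove-holds {X = Y} Yw w≢v)
    preserves′ : ∀ u w → Y u holds → Y w holds → Adj F u w → Adj G (to′ u) (to′ w)
    preserves′ u w Yu Yw uw with u ≟ᶠ v | w ≟ᶠ v
    ... | yes refl | yes refl = contradiction refl (adj⇒≢ F uw)
    ... | yes refl | no _     = adj-sym G (attached w Yw uw)
    ... | no _     | yes refl = attached u Yu (adj-sym F uw)
    ... | no u≢v   | no w≢v   = preserves u w (remove-holds {X = Y} Yu u≢v) (remove-holds {X = Y} Yw w≢v) uw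
    inside′ : ∀ u → core (to′ u) holds
    inside′ u with u ≟ᶠ v
    ... | yes _ = ∧-holdsˡ (proj₁ (proj₂ new))
    ... | no  _ = inside u

  embed : ∀ fuel Y → count Y ≤ fuel → PartialEmbedding Y
  embed fuel Y small with any? (λ v → (Y v ≟ᵇ true) ×-dec (neighbours-in F Y v <? 2)) | any? (λ v → Y v ≟ᵇ true)
  ... | no none | no empty = record
    { to = const root ; injective = λ u _ Yu → contradiction (u , Yu) empty
    ; preserves = λ u _ Yu → contradiction (u , Yu) empty ; inside = λ _ → root∈ }
  ... | no none | yes (v , Yv) = contradiction (proj₂ cycle) (forest (proj₁ cycle))
    where
    cycle : ∃[ m ] Cycle F m
    cycle = core-has-cycle {X = Y} record
      { core = Y ; core⊆ = λ _ Yv → Yv ; root = v ; root∈ = Yv ; degrees = λ w Yw → ≮⇒≥ (λ lt → none (w , Yw , lt)) }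
  embed zero Y small | yes (v , Yv , _) | _ = contradiction small (<⇒≱ (count-positive Y v Yv))
  embed (suc fuel) Y small | yes (v , Yv , few) | _ =
    add-leaf Y v Yv few (embed fuel (remove v Y) (≤-pred (≤-trans (count-remove {X = Y} Yv) small)))

  embedding : PartialEmbedding (const true)
  embedding = embed _ (const true) ≤-refl

-- Sauer–Shelah and packing

-- The recursion is on the first coordinate, the one on which the Sauer-Shelah induction splits.
cube-count : ∀ s → (Vec Bool s → Bool) → ℕ
cube-count zero    P = bit (P [])
cube-count (suc s) P = cube-count s (P ∘ (true ∷_)) + cube-count s (P ∘ (false ∷_))

cube-count-inclusion-exclusion : ∀ s (P Q : Vec Bool s → Bool) →
  cube-count s P + cube-count s Q ≡ cube-count s (λ v → P v ∨ Q v) + cube-count s (λ v → P v ∧ Q v)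
cube-count-inclusion-exclusion zero P Q with P [] | Q []
... | true  | true  = refl
... | true  | false = refl
... | false | true  = refl
... | false | false = refl
cube-count-inclusion-exclusion (suc s) P Q = begin
  (p₁ + p₀) + (q₁ + q₀)   ≡⟨ interchange p₁ p₀ q₁ q₀ ⟩
  (p₁ + q₁) + (p₀ + q₀)   ≡⟨ cong₂ _+_ (cube-count-inclusion-exclusion s _ _) (cube-count-inclusion-exclusion s _ _) ⟩
  (u₁ + i₁) + (u₀ + i₀)   ≡⟨ interchange u₁ i₁ u₀ i₀ ⟩
  (u₁ + u₀) + (i₁ + i₀)   ∎
  where
  open ≡-Reasoning
  interchange : ∀ a b c d → (a + b) + (c + d) ≡ (a + c) + (b + d)
  interchange = solve-∀
  p₁ = cube-count s (P ∘ (true ∷_))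
  p₀ = cube-count s (P ∘ (false ∷_))
  q₁ = cube-count s (Q ∘ (true ∷_))
  q₀ = cube-count s (Q ∘ (false ∷_))
  u₁ = cube-count s (λ v → P (true ∷ v) ∨ Q (true ∷ v))
  u₀ = cube-count s (λ v → P (false ∷ v) ∨ Q (false ∷ v))
  i₁ = cube-count s (λ v → P (true ∷ v) ∧ Q (true ∷ v))
  i₀ = cube-count s (λ v → P (false ∷ v) ∧ Q (false ∷ v))

cube-choose : ∀ s P → 0 < cube-count s P → ∃[ v ] P v holds
cube-choose zero P pos with P [] in eq
... | true = [] , eq
cube-choose (suc s) P pos with cube-count s (P ∘ (true ∷_)) in eq
... | suc _ = let v , Pv = cube-choose s (P ∘ (true ∷_)) (subst (0 <_) (sym eq) (s≤s z≤n)) in true ∷ v , Pv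
... | zero  = let v , Pv = cube-choose s (P ∘ (false ∷_)) pos in false ∷ v , Pv

cube-rank : ∀ s P v → P v holds → Fin (cube-count s P)
cube-rank zero    P []          Pv rewrite Pv = zero
cube-rank (suc s) P (true  ∷ v) Pv = cube-rank s (P ∘ (true ∷_)) v Pv ↑ˡ cube-count s (P ∘ (false ∷_))
cube-rank (suc s) P (false ∷ v) Pv = cube-count s (P ∘ (true ∷_)) ↑ʳ cube-rank s (P ∘ (false ∷_)) v Pv

cube-rank-injective : ∀ s P u v (Pu : P u holds) (Pv : P v holds) → cube-rank s P u Pu ≡ cube-rank s P v Pv → u ≡ v
cube-rank-injective zero    P []          []          Pu Pv eq = refl
cube-rank-injective (suc s) P (true  ∷ u) (true  ∷ v) Pu Pv eq =
  cong (true ∷_) (cube-rank-injective s _ u v Pu Pv (↑ˡ-injective _ _ _ eq))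
cube-rank-injective (suc s) P (false ∷ u) (false ∷ v) Pu Pv eq =
  cong (false ∷_) (cube-rank-injective s _ u v Pu Pv (↑ʳ-injective (cube-count s (P ∘ (true ∷_))) _ _ eq))
cube-rank-injective (suc s) P (true  ∷ u) (false ∷ v) Pu Pv eq = contradiction
  (trans (sym (splitAt-↑ˡ (cube-count s (P ∘ (true ∷_))) _ _)) (trans (cong (splitAt _) eq) (splitAt-↑ʳ (cube-count s (P ∘ (true ∷_))) _ _))) λ ()
cube-rank-injective (suc s) P (false ∷ u) (true  ∷ v) Pu Pv eq = contradiction
  (trans (sym (splitAt-↑ʳ (cube-count s (P ∘ (true ∷_))) _ _)) (trans (cong (splitAt _) eq) (splitAt-↑ˡ (cube-count s (P ∘ (true ∷_))) _ _))) λ ()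

-- The sum of the binomial coefficients `C(s, i)` over `i < D`, defined through Pascal's rule.
sauer-bound : ℕ → ℕ → ℕ
sauer-bound _       zero    = 0
sauer-bound zero    (suc D) = 1
sauer-bound (suc s) (suc D) = sauer-bound s (suc D) + sauer-bound s D

-- Deleting the first coordinate gives the family of projections (`∨`) and the family of vectors
-- with both extensions (`∧`), whose sizes add up to that of `P`, so one of them exceeds its bound.
-- The first then shatters `suc D` later coordinates; the second shatters `D` of them, to which the
-- first coordinate can be added. Distinctness of the values of `e` is implied by the realisation of
-- all patterns.
sauer-shelah : ∀ s D (P : Vec Bool s → Bool) → sauer-bound s D < cube-count s P →
  Σ[ e ∈ (Fin D → Fin s) ] (∀ (p : Fin D → Bool) → ∃[ v ] (P v holds × (∀ a → lookup v (e a) ≡ p a)))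
sauer-shelah s zero P many = (λ ()) , λ _ → let v , Pv = cube-choose s P many in v , Pv , λ ()
sauer-shelah zero (suc D) P many with P []
... | true  = contradiction many (<-irrefl refl)
... | false = contradiction many λ ()
sauer-shelah (suc s) (suc D) P many with sauer-bound s (suc D) <? cube-count s (λ v → P (true ∷ v) ∨ P (false ∷ v))
... | yes many∨ = suc ∘ proj₁ IH , λ p → let v , Pv , agree = proj₂ IH p in lift p v Pv agree
  where
  IH = sauer-shelah s (suc D) _ many∨
  lift : ∀ (p : Fin (suc D) → Bool) v → (P (true ∷ v) ∨ P (false ∷ v)) holds → (∀ a → lookup v (proj₁ IH a) ≡ p a) →
    ∃[ w ] (P w holds × (∀ a → lookup w (suc (proj₁ IH a)) ≡ p a))
  lift p v Pv agree with P (true ∷ v) in eq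
  ... | true  = true ∷ v , eq , agree
  ... | false = false ∷ v , Pv , agree
... | no few∨ = (λ { zero → zero ; (suc a) → suc (proj₁ IH a) }) , λ p →
    let v , Pv , agree = proj₂ IH (p ∘ suc) in p zero ∷ v , both (p zero) v Pv , λ { zero → refl ; (suc a) → agree a }
  where
  many∧ : sauer-bound s D < cube-count s (λ v → P (true ∷ v) ∧ P (false ∷ v))
  many∧ = ≰⇒> λ few∧ → contradiction (≤-trans (≤-reflexive (cube-count-inclusion-exclusion s _ _))
    (+-mono-≤ (≮⇒≥ few∨) few∧)) (<⇒≱ many)
  IH = sauer-shelah s D _ many∧
  both : ∀ b v → (P (true ∷ v) ∧ P (false ∷ v)) holds → P (b ∷ v) holds
  both true  v = ∧-holdsˡ
  both false v = ∧-holdsʳ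

-- Polynomial against exponential growth.

sauer-bound-polynomial : ∀ s D → sauer-bound s D ≤ suc s ^ D
sauer-bound-polynomial s       zero    = z≤n
sauer-bound-polynomial zero    (suc D) = ≤-reflexive (sym (^-zeroˡ (suc D)))
sauer-bound-polynomial (suc s) (suc D) = begin
  sauer-bound s (suc D) + sauer-bound s D   ≤⟨ +-mono-≤ (sauer-bound-polynomial s (suc D)) (sauer-bound-polynomial s D) ⟩
  suc s * suc s ^ D + suc s ^ D             ≡⟨ +-comm (suc s * suc s ^ D) _ ⟩
  suc (suc s) * suc s ^ D                   ≤⟨ *-monoʳ-≤ (suc (suc s)) (^-monoˡ-≤ D (n≤1+n (suc s))) ⟩
  suc (suc s) ^ suc D                       ∎
  where open ≤-Reasoning

bernoulli : ∀ p t → p ^ t + t * p ^ (t ∸ 1) ≤ suc p ^ t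
bernoulli p zero    = ≤-refl
bernoulli p (suc t) = begin
  p * p ^ t + (p ^ t + t * p ^ t)             ≤⟨ +-monoʳ-≤ (p * p ^ t) (+-monoʳ-≤ (p ^ t) (shift t)) ⟩
  p * p ^ t + (p ^ t + p * (t * p ^ (t ∸ 1)))  ≤⟨ +-monoʳ-≤ (p * p ^ t) (+-monoʳ-≤ (p ^ t) (m≤n+m _ (t * p ^ (t ∸ 1)))) ⟩
  p * p ^ t + (p ^ t + (t * p ^ (t ∸ 1) + p * (t * p ^ (t ∸ 1)))) ≡⟨ regroup p (p ^ t) (t * p ^ (t ∸ 1)) ⟩
  suc p * (p ^ t + t * p ^ (t ∸ 1))           ≤⟨ *-monoʳ-≤ (suc p) (bernoulli p t) ⟩
  suc p ^ suc t                               ∎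
  where
  open ≤-Reasoning
  shift : ∀ t → t * p ^ t ≤ p * (t * p ^ (t ∸ 1))
  shift zero    = z≤n
  shift (suc t) = ≤-reflexive (swap (suc t) p (p ^ t))
    where
    swap : ∀ a b c → a * (b * c) ≡ b * (a * c)
    swap = solve-∀
  regroup : ∀ p a b → p * a + (a + (b + p * b)) ≡ suc p * (a + b)
  regroup = solve-∀

-- For exponent and base both `p + 1`, the two terms of `bernoulli` are equal. In other words,
-- `(1 + 1 / (p + 1)) ^ (p + 1)` is at least 2.
doubling : ∀ p → 2 * suc p ^ suc p ≤ suc (suc p) ^ suc p
doubling p = ≤-trans (≤-reflexive (cong ((suc p ^ suc p) +_) (+-identityʳ _))) (bernoulli (suc p) (suc p))

n<2^n : ∀ n → n < 2 ^ n
n<2^n zero    = s≤s z≤n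
n<2^n (suc n) = begin
  2 + n                 ≡⟨ +-comm 1 (suc n) ⟩
  suc n + 1             ≤⟨ +-mono-≤ (n<2^n n) (≤-trans (s≤s z≤n) (n<2^n n)) ⟩
  2 ^ n + 2 ^ n         ≡⟨ cong ((2 ^ n) +_) (sym (+-identityʳ _)) ⟩
  2 ^ suc n             ∎
  where open ≤-Reasoning

linear<exponential : ∀ c D → ∃[ u ] (u + c) * D < 2 ^ u
linear<exponential c D = v + v , (begin-strict
  (v + v + c) * D      ≤⟨ dominated D ⟩
  v * v                <⟨ *-mono-< (n<2^n v) (n<2^n v) ⟩
  2 ^ v * 2 ^ v        ≡⟨ sym (^-distribˡ-+-* 2 v v) ⟩
  2 ^ (v + v)          ∎)
  where
  open ≤-Reasoning
  -- Chosen so that `(2 v + c) D ≤ v ^ 2`; squaring `v < 2 ^ v` gives the rest.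
  v = (c + 2) * D
  expand : ∀ c D → (c + 2) * suc D * ((c + 2) * suc D) ≡
    ((c + 2) * suc D + (c + 2) * suc D + c) * suc D + c * (c + 2) * suc D * D + c * (c + 1) * suc D
  expand = solve-∀
  dominated : ∀ D → ((c + 2) * D + (c + 2) * D + c) * D ≤ (c + 2) * D * ((c + 2) * D)
  dominated zero    = ≤-trans (≤-reflexive (*-zeroʳ ((c + 2) * 0 + (c + 2) * 0 + c))) z≤n
  dominated (suc D) = ≤-trans (≤-trans (m≤m+n _ _) (m≤m+n _ _)) (≤-reflexive (sym (expand c D)))

^-distribʳ-* : ∀ t a b → (a * b) ^ t ≡ a ^ t * b ^ t
^-distribʳ-* zero    a b = refl
^-distribʳ-* (suc t) a b = trans (cong ((a * b) *_) (^-distribʳ-* t a b)) (interchange a b (a ^ t) (b ^ t))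
  where
  interchange : ∀ a b c d → a * b * (c * d) ≡ a * c * (b * d)
  interchange = solve-∀

-- For `s = (p + 1) * 2 ^ u`, applying `doubling` `2 ^ u` times gains a factor `2 ^ (2 ^ u)`,
-- whereas `(s + 2) ^ D` is at most `2 ^ ((u + p + 2) * D)`.
polynomial<exponential : ∀ p D → ∃[ s ] (s + 2) ^ D * suc p ^ s < suc (suc p) ^ s
polynomial<exponential p D = s , (begin-strict
  (s + 2) ^ D * suc p ^ s                   ≤⟨ *-monoˡ-≤ (suc p ^ s) base ⟩
  2 ^ ((u + (p + 2)) * D) * suc p ^ s       <⟨ *-monoˡ-< (suc p ^ s) {{m^n≢0 (suc p) s}} (^-monoʳ-< 2 (s≤s (s≤s z≤n)) (proj₂ (linear<exponential (p + 2) D))) ⟩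
  2 ^ t * suc p ^ s                         ≡⟨ cong ((2 ^ t) *_) (sym (^-*-assoc (suc p) (suc p) t)) ⟩
  2 ^ t * (suc p ^ suc p) ^ t               ≡⟨ sym (^-distribʳ-* t 2 (suc p ^ suc p)) ⟩
  (2 * suc p ^ suc p) ^ t                   ≤⟨ ^-monoˡ-≤ t (doubling p) ⟩
  (suc (suc p) ^ suc p) ^ t                 ≡⟨ ^-*-assoc (suc (suc p)) (suc p) t ⟩
  suc (suc p) ^ s                           ∎)
  where
  open ≤-Reasoning
  u = proj₁ (linear<exponential (p + 2) D)
  t = 2 ^ u
  s = suc p * t
  base : (s + 2) ^ D ≤ 2 ^ ((u + (p + 2)) * D)
  base = begin
    (s + 2) ^ D                   ≤⟨ ^-monoˡ-≤ D (+-monoʳ-≤ s (*-monoʳ-≤ 2 (m^n>0 2 u))) ⟩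
    (suc p * t + 2 * t) ^ D       ≡⟨ cong (_^ D) (regroup p t) ⟩
    (t * (p + 3)) ^ D             ≤⟨ ^-monoˡ-≤ D (*-monoʳ-≤ t (≤-trans (≤-reflexive (+-suc p 2)) (n<2^n (p + 2)))) ⟩
    (2 ^ u * 2 ^ (p + 2)) ^ D     ≡⟨ cong (_^ D) (sym (^-distribˡ-+-* 2 u (p + 2))) ⟩
    (2 ^ (u + (p + 2))) ^ D       ≡⟨ ^-*-assoc 2 (u + (p + 2)) D ⟩
    2 ^ ((u + (p + 2)) * D)       ∎
    where
    regroup : ∀ p t → suc p * t + 2 * t ≡ t * (p + 3)
    regroup = solve-∀

-- Packings and nets for the Hamming distance between neighbourhoods.

module _ (G : Graph) where
  open Graph G using (adj)

  distance : Vertex G → Vertex G → ℕ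
  distance u v = count (λ x → adj u x xor adj v x)

  count² : ∀ {m} → (Fin m → Fin m → Bool) → ℕ
  count² R = sum (λ i → count (R i))

  count²-positive : ∀ {m} (R : Fin m → Fin m → Bool) i j → R i j holds → 0 < count² R
  count²-positive R i j Rij = ≤-trans (count-positive (R i) j Rij) (term≤sum (λ i → count (R i)) i)

  count²-≤ : ∀ {m} (R : Fin m → Fin m → Bool) → count² R ≤ m * m
  count²-≤ {m} R = sum-≤-const m (λ i → count-≤ (R i))

  count²-split : ∀ {m} (R Q : Fin m → Fin m → Bool) →
    count² R ≡ count² (λ i j → R i j ∧ Q i j) + count² (λ i j → R i j ∧ not (Q i j))
  count²-split R Q = trans (sum-cong-≗ (λ i → count-split (R i) (Q i)))
    (∑-distrib-+ (λ i → count (λ j → R i j ∧ Q i j)) (λ i → count (λ j → R i j ∧ not (Q i j))))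

  module Separation (q : ℕ) {m : ℕ} (u : Fin m → Vertex G) where
    separated : Vertex G → Fin m → Fin m → Bool
    separated x i j = adj (u i) x xor adj (u j) x

    Far : (Fin m → Fin m → Bool) → Set
    Far R = ∀ i j → R i j holds → order G ≤ suc q * distance (u i) (u j)

    total-separation : ∀ R → Far R →
      order G * count² R ≤ suc q * sum (λ x → count² (λ i j → R i j ∧ separated x i j))
    total-separation R far = begin
      n * count² R                                                    ≡⟨ *-distribˡ-sum n (λ i → count (R i)) ⟩
      sum (λ i → n * count (R i))                                     ≡⟨ sum-cong-≗ (λ i → *-distribˡ-sum n (λ j → bit (R i j))) ⟩
      sum (λ i → sum (λ j → n * bit (R i j)))                         ≤⟨ sum-mono (λ i → sum-mono (λ j → pointwise i j)) ⟩
      sum (λ i → sum (λ j → suc q * sum (λ x → sep i j x)))           ≡⟨ sum-cong-≗ (λ i → sym (*-distribˡ-sum (suc q) (λ j → sum (λ x → sep i j x)))) ⟩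
      sum (λ i → suc q * sum (λ j → sum (λ x → sep i j x)))           ≡⟨ sym (*-distribˡ-sum (suc q) (λ i → sum (λ j → sum (λ x → sep i j x)))) ⟩
      suc q * sum (λ i → sum (λ j → sum (λ x → sep i j x)))           ≡⟨ cong (suc q *_) (sum-cong-≗ (λ i → ∑-comm (λ j x → sep i j x))) ⟩
      suc q * sum (λ i → sum (λ x → sum (λ j → sep i j x)))           ≡⟨ cong (suc q *_) (∑-comm (λ i x → sum (λ j → sep i j x))) ⟩
      suc q * sum (λ x → count² (λ i j → R i j ∧ separated x i j))    ∎
      where
      open ≤-Reasoning
      n = order G
      sep : Fin m → Fin m → Vertex G → ℕ
      sep i j x = bit (R i j ∧ separated x i j)
      pointwise : ∀ i j → n * bit (R i j) ≤ suc q * sum (λ x → sep i j x)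
      pointwise i j with R i j | far i j
      ... | true  | large = ≤-trans (≤-reflexive (*-identityʳ n)) (large refl)
      ... | false | _     = ≤-trans (≤-reflexive (*-zeroʳ n)) z≤n

    -- If every vertex separated less than a `1 / (q + 1)` share of the pairs in `R`, summing over
    -- all vertices would contradict `total-separation`. The vertex `v` makes the sum nonempty, as
    -- its strictness demands.
    best-separator : Vertex G → ∀ R → Far R →
      ∃[ x ] suc q * count² (λ i j → R i j ∧ not (separated x i j)) ≤ q * count² R
    best-separator v R far with any? (λ x → count² R ≤? suc q * count² (λ i j → R i j ∧ separated x i j))
    ... | yes (x , many) = x , +-cancelˡ-≤ (count² R) _ _ (begin
      count² R + suc q * k    ≤⟨ +-monoˡ-≤ (suc q * k) many ⟩
      suc q * s + suc q * k   ≡⟨ sym (*-distribˡ-+ (suc q) s k) ⟩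
      suc q * (s + k)         ≡⟨ cong (suc q *_) (sym (count²-split R (separated x))) ⟩
      count² R + q * count² R ∎)
      where
      open ≤-Reasoning
      s = count² (λ i j → R i j ∧ separated x i j)
      k = count² (λ i j → R i j ∧ not (separated x i j))
    ... | no none = contradiction (total-separation R far) (<⇒≱ (begin-strict
      suc q * sum f                  ≡⟨ *-distribˡ-sum (suc q) f ⟩
      sum (λ x → suc q * f x)        <⟨ sum-<-const v (λ x → ≰⇒> (λ le → none (x , le))) ⟩
      order G * count² R             ∎))
      where
      open ≤-Reasoning
      f : Vertex G → ℕ
      f x = count² (λ i j → R i j ∧ separated x i j)
      sum-<-const : ∀ {n c} {f : Fin n → ℕ} → Fin n → (∀ x → f x < c) → sum f < n * c
      sum-<-const {suc n} {c} _ f<c = +-mono-<-≤ (f<c zero) (sum-≤-const c (λ x → <⇒≤ (f<c (suc x))))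

    separating-points : Vertex G → ∀ s R → Far R → Σ[ xs ∈ (Fin s → Vertex G) ] Σ[ R′ ∈ (Fin m → Fin m → Bool) ]
      ((∀ i j → R i j holds → (∀ a → adj (u i) (xs a) ≡ adj (u j) (xs a)) → R′ i j holds)
       × suc q ^ s * count² R′ ≤ q ^ s * count² R)
    separating-points v zero    R far = (λ ()) , R , (λ _ _ Rij _ → Rij) , ≤-refl
    separating-points v (suc s) R far =
      let x , drop = best-separator v R far
          R₁ = λ i j → R i j ∧ not (separated x i j)
          xs , R′ , survive , small = separating-points v s R₁ (λ i j R₁ij → far i j (∧-holdsˡ R₁ij))
      in (λ { zero → x ; (suc a) → xs a }) , R′
         , (λ i j Rij same → survive i j (∧-holds Rij (unseparated (adj (u i) x) (adj (u j) x) (same zero))) (same ∘ suc))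
         , (begin
            suc q * suc q ^ s * count² R′    ≡⟨ *-assoc (suc q) (suc q ^ s) _ ⟩
            suc q * (suc q ^ s * count² R′)  ≤⟨ *-monoʳ-≤ (suc q) small ⟩
            suc q * (q ^ s * count² R₁)      ≡⟨ swap (suc q) (q ^ s) (count² R₁) ⟩
            q ^ s * (suc q * count² R₁)      ≤⟨ *-monoʳ-≤ (q ^ s) drop ⟩
            q ^ s * (q * count² R)           ≡⟨ swap′ q (q ^ s) (count² R) ⟩
            q * q ^ s * count² R             ∎)
      where
      open ≤-Reasoning
      swap : ∀ a b c → a * (b * c) ≡ b * (a * c)
      swap = solve-∀
      swap′ : ∀ a b c → b * (a * c) ≡ a * b * c
      swap′ = solve-∀
      unseparated : ∀ a b → a ≡ b → not (a xor b) holds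
      unseparated true  true  refl = refl
      unseparated false false refl = refl

  ShatteredFamily : ℕ → Set
  ShatteredFamily D = Σ[ y ∈ (Fin D → Vertex G) ] (∀ (p : Fin D → Bool) → ∃[ v ] (∀ a → adj v (y a) ≡ p a))

  packing⇒shattered : ∀ q D s m → Vertex G → m * m * q ^ s < suc q ^ s → sauer-bound s D < m →
    (u : Fin m → Vertex G) → (∀ i j → i ≢ j → order G ≤ suc q * distance (u i) (u j)) → ShatteredFamily D
  packing⇒shattered q D s m v few many u far =
    let e , shatters = sauer-shelah s D occurs (<-≤-trans many (injective⇒≤ {f = rank} rank-injective))
    in xs ∘ e , λ p →
      let w , w-occurs , agree = shatters p
          i , i≡w = does⇒ (any? (is-trace? w)) w-occurs
      in u i , λ a → trans (sym (lookup∘tabulate _ (e a))) (trans (cong (λ w → lookup w (e a)) i≡w) (agree a))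
    where
    open Separation q u
    R : Fin m → Fin m → Bool
    R i j = not (does (i ≟ᶠ j))
    R⇒≢ : ∀ i j → R i j holds → i ≢ j
    R⇒≢ i j Rij i≡j = contradiction (trans (sym Rij) (cong not (dec-true (i ≟ᶠ j) i≡j))) λ ()
    points = separating-points v s R (λ i j Rij → far i j (R⇒≢ i j Rij))
    xs = proj₁ points
    R′ = proj₁ (proj₂ points)
    trace : Fin m → Vec Bool s
    trace i = tabulate (λ a → adj (u i) (xs a))
    trace-injective : Injective _≡_ _≡_ trace
    trace-injective {i} {j} eq with i ≟ᶠ j
    ... | yes i≡j = i≡j
    ... | no  i≢j = contradiction (≤-trans small-product large-product) (<⇒≱ few)
      where
      same : ∀ a → adj (u i) (xs a) ≡ adj (u j) (xs a)
      same a = trans (sym (lookup∘tabulate _ a)) (trans (cong (λ w → lookup w a) eq) (lookup∘tabulate _ a))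
      survives : R′ i j holds
      survives = proj₁ (proj₂ (proj₂ points)) i j (cong not (dec-false (i ≟ᶠ j) i≢j)) same
      -- One surviving pair makes `count² R′` positive, so `suc q ^ s` would be at most `q ^ s`
      -- times the number of pairs, against `few`.
      small-product : suc q ^ s ≤ q ^ s * count² R
      small-product = ≤-trans (≤-trans (≤-reflexive (sym (*-identityʳ _))) (*-monoʳ-≤ (suc q ^ s) (count²-positive R′ i j survives)))
        (proj₂ (proj₂ (proj₂ points)))
      large-product : q ^ s * count² R ≤ m * m * q ^ s
      large-product = ≤-trans (*-monoʳ-≤ (q ^ s) (count²-≤ R)) (≤-reflexive (*-comm (q ^ s) (m * m)))
    is-trace? : ∀ w i → Dec (trace i ≡ w)
    is-trace? w i = ≡-decᵛ _≟ᵇ_ (trace i) w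
    occurs : Vec Bool s → Bool
    occurs w = does (any? (is-trace? w))
    trace-occurs : ∀ i → occurs (trace i) holds
    trace-occurs i = dec-true (any? (is-trace? (trace i))) (i , refl)
    rank : Fin m → Fin (cube-count s occurs)
    rank i = cube-rank s occurs (trace i) (trace-occurs i)
    rank-injective : Injective _≡_ _≡_ rank
    rank-injective {i} {j} eq = trace-injective (cube-rank-injective s occurs (trace i) (trace j) (trace-occurs i) (trace-occurs j) eq)

  shattered-family⇒shattered : ∀ {D} → ShatteredFamily D → ∃[ S ] (Shattered G S × D ≤ ∣ S ∣)
  shattered-family⇒shattered {D} (y , realise) =
    tabulate image , (λ T → mk⇔ (λ { (v , refl) → p∩q⊆q (N G v) (tabulate image) }) (from T))
    , ≤-trans (injection⇒≤count image y y-injective y∈image) (≤-reflexive (sym (∣tabulate∣≡count image)))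
    where
    image : Vertex G → Bool
    image v = does (any? (λ a → y a ≟ᶠ v))
    y∈image : ∀ a → image (y a) holds
    y∈image a = dec-true (any? (λ b → y b ≟ᶠ y a)) (a , refl)
    y-injective : Injective _≡_ _≡_ y
    y-injective {a} {b} ya≡yb with a ≟ᶠ b
    ... | yes a≡b = a≡b
    -- The pattern that holds at `a` alone is realised by a vertex that tells `y a` from `y b`.
    ... | no  a≢b = let v , agree = realise (λ c → does (a ≟ᶠ c)) in contradiction
      (trans (sym (dec-true (a ≟ᶠ a) refl)) (trans (sym (agree a)) (trans (cong (adj v) ya≡yb) (trans (agree b) (dec-false (a ≟ᶠ b) a≢b))))) λ ()
    from : ∀ T → T ⊆ tabulate image → ∃[ v ] N G v ∩ tabulate image ≡ T
    from T T⊆ = let v , agree = realise (λ a → lookup T (y a)) in v ,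
      trans (sym (tabulate∘lookup _)) (trans (tabulate-cong (pointwise v agree)) (tabulate∘lookup T))
      where
      pointwise : ∀ v → (∀ a → adj v (y a) ≡ lookup T (y a)) → ∀ x → lookup (N G v ∩ tabulate image) x ≡ lookup T x
      pointwise v agree x = trans (lookup-zipWith _∧_ x (N G v) (tabulate image))
        (trans (cong₂ _∧_ (lookup∘tabulate (adj v) x) (lookup∘tabulate image x)) (by-cases (any? (λ a → y a ≟ᶠ x)) refl))
        where
        by-cases : (d : Dec (∃[ a ] y a ≡ x)) → does (any? (λ a → y a ≟ᶠ x)) ≡ does d → adj v x ∧ image x ≡ lookup T x
        by-cases (yes (a , refl)) eq rewrite eq = trans (∧-comm (adj v x) true) (agree a)
        by-cases (no none)        eq rewrite eq = trans (∧-comm (adj v x) false) (sym (outside (lookup T x) refl))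
          where
          outside : ∀ b → lookup T x ≡ b → b ≡ false
          outside false _  = refl
          outside true  Tx = contradiction
            (does⇒ (any? (λ a → y a ≟ᶠ x)) (trans (sym (lookup∘tabulate image x)) ([]=⇒lookup (T⊆ (lookup⇒[]= x T Tx))))) none

  distance-sym : ∀ u v → distance u v ≡ distance v u
  distance-sym u v = sum-cong-≗ (λ x → cong bit (xor-comm (adj u x) (adj v x)))

  -- Greedy choice: as long as some vertex is remote from the chosen ones it is added, and otherwise
  -- these form a net. A net with fewer than `M` centres is padded with `v₀`, so that its size does
  -- not depend on the graph.
  net-or-packing : Vertex G → ∀ q M →
    (Σ[ u ∈ (Fin M → Vertex G) ] (∀ i j → i ≢ j → order G ≤ suc q * distance (u i) (u j)))
    ⊎ (Σ[ z ∈ (Fin M → Vertex G) ] Σ[ c ∈ (Vertex G → Fin M) ] (∀ v → suc q * distance v (z (c v)) ≤ order G))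
  net-or-packing v₀ q zero = inj₁ ((λ ()) , λ ())
  net-or-packing v₀ q (suc M) with net-or-packing v₀ q M
  ... | inj₂ (z , c , near) = inj₂ ((λ { zero → v₀ ; (suc i) → z i }) , suc ∘ c , near)
  ... | inj₁ (u , far) with all? (λ v → any? (λ i → suc q * distance v (u i) ≤? order G))
  ...   | yes near = inj₂ ((λ { zero → v₀ ; (suc i) → u i }) , (λ v → suc (proj₁ (near v))) , λ v → proj₂ (near v))
  ...   | no ¬near = inj₁ (u′ , far′)
    where
    remote : ∃[ v ] ¬ (∃[ i ] suc q * distance v (u i) ≤ order G)
    remote = ¬∀⟶∃¬ _ _ (λ v → any? (λ i → suc q * distance v (u i) ≤? order G)) ¬near
    v = proj₁ remote
    v-far : ∀ i → order G ≤ suc q * distance v (u i)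
    v-far i = <⇒≤ (≰⇒> (λ le → proj₂ remote (i , le)))
    u′ : Fin (suc M) → Vertex G
    u′ zero    = v
    u′ (suc i) = u i
    far′ : ∀ i j → i ≢ j → order G ≤ suc q * distance (u′ i) (u′ j)
    far′ zero    zero    i≢j = contradiction refl i≢j
    far′ zero    (suc j) i≢j = v-far j
    far′ (suc i) zero    i≢j = ≤-trans (v-far i) (≤-reflexive (cong (suc q *_) (distance-sym v (u i))))
    far′ (suc i) (suc j) i≢j = far i j (i≢j ∘ cong suc)

-- In a large packing, greedily chosen points cut the unseparated pairs by a
-- constant factor each, while by Sauer–Shelah the number of traces on these
-- points is only polynomial.
neighbourhood-net : ∀ q d → ∃[ M ] (∀ G m → Vertex G → HasVCDimension G m → m ≤ d →
  Σ[ z ∈ (Fin M → Vertex G) ] Σ[ c ∈ (Vertex G → Fin M) ] (∀ v → suc (suc q) * distance G v (z (c v)) ≤ order G))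
neighbourhood-net q d = M , λ G m v₀ (_ , maximal) m≤d → case net-or-packing G v₀ (suc q) M of λ where
    (inj₂ net) → net
    (inj₁ (u , far)) →
      let S , shattered , large = shattered-family⇒shattered G (packing⇒shattered G (suc q) D s M v₀ few ≤-refl u far)
      in contradiction (≤-trans large (≤-trans (maximal ∣ S ∣ (S , shattered , refl)) m≤d)) (<⇒≱ (n<1+n d))
  where
  D = suc d
  -- The exponent is `D + D` because the number of pairs is bounded by `M * M`, and `M` by
  -- `(s + 2) ^ D`.
  s = proj₁ (polynomial<exponential q (D + D))
  M = suc (sauer-bound s D)
  M≤ : M ≤ (s + 2) ^ D
  M≤ = begin
    suc (sauer-bound s D)                 ≤⟨ s≤s (sauer-bound-polynomial s D) ⟩
    1 + suc s ^ D                         ≤⟨ +-monoˡ-≤ (suc s ^ D) (m^n>0 (suc s) d) ⟩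
    suc s ^ d + suc s ^ D                 ≡⟨⟩
    suc (suc s) * suc s ^ d               ≤⟨ *-monoʳ-≤ (suc (suc s)) (^-monoˡ-≤ d (n≤1+n (suc s))) ⟩
    suc (suc s) ^ D                       ≡⟨ cong (_^ D) (+-comm 2 s) ⟩
    (s + 2) ^ D                           ∎
    where open ≤-Reasoning
  few : M * M * suc q ^ s < suc (suc q) ^ s
  few = ≤-<-trans (*-monoˡ-≤ (suc q ^ s) (≤-trans (*-mono-≤ M≤ M≤) (≤-reflexive (sym (^-distribˡ-+-* (s + 2) D D)))))
    (proj₂ (polynomial<exponential q (D + D)))

-- Upper bounds

colourable-mono : ∀ {G k l} → k ≤ l → Colourable G k → Colourable G l
colourable-mono k≤l (c , proper) = (λ v → inject≤ (c v) k≤l) , λ u v uv eq → proper u v uv (inject≤-injective k≤l k≤l _ _ eq)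

order-colourable : ∀ G → Colourable G (order G)
order-colourable G = id , λ u v uv → adj⇒≢ G uv

nonneighbours-few : ∀ G a q → (∀ v → a * order G ≤ q * degree G v) →
  ∀ v → q * count (not ∘ Graph.adj G v) ≤ (q ∸ a) * order G
nonneighbours-few G a q dense v = begin
  q * miss                               ≡⟨ sym (m+n∸m≡n (q * deg) (q * miss)) ⟩
  q * deg + q * miss ∸ q * deg           ≡⟨ cong (_∸ q * deg) (sym (*-distribˡ-+ q deg miss)) ⟩
  q * (deg + miss) ∸ q * deg             ≡⟨ cong (λ n → q * n ∸ q * deg) (count-not (Graph.adj G v)) ⟩
  q * order G ∸ q * deg                  ≤⟨ ∸-monoʳ-≤ (q * order G) (subst (λ d → a * order G ≤ q * d) (∣tabulate∣≡count (Graph.adj G v)) (dense v)) ⟩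
  q * order G ∸ a * order G              ≡⟨ sym (*-distribʳ-∸ (order G) q a) ⟩
  (q ∸ a) * order G                      ∎
  where
  open ≤-Reasoning
  deg = count (Graph.adj G v)
  miss = count (not ∘ Graph.adj G v)

-- `a / q > k / (k + 1)` amounts to `k (1 - a / q) < a / q`: the non-neighbours of `k` vertices do
-- not exhaust one neighbourhood.
∸-slack : ∀ k q a → k * q < a * suc k → k * (q ∸ a) < a
∸-slack k q zero    lt = contradiction lt λ ()
∸-slack k q (suc a) lt = subst (_< suc a) (sym (*-distribˡ-∸ k q (suc a)))
  (m<n+o⇒m∸n<o (k * q) (k * suc a) (<-≤-trans lt (≤-reflexive (trans (*-comm (suc a) (suc k)) (+-comm (suc a) _)))))

-- Each vertex `v` takes position `v` in the part of its colour, so parts of size `order H` suffice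
-- whatever the sizes of the colour classes.
copy-of-coloured : ∀ {H G W r} → Colourable H r → CompletePartite G W r (order H) → Copy H G
copy-of-coloured {H} {G} (c , proper) A = record
  { to        = λ v → vertex (c v) v
  ; injective = λ {u} {v} → inj u v
  ; preserves = λ {u} {v} uv → cross (proper u v uv) u v
  }
  where
  open CompletePartite A
  inj : ∀ u v → vertex (c u) u ≡ vertex (c v) v → u ≡ v
  inj u v eq with c u ≟ᶠ c v
  ... | yes same = injective (c v) (trans (cong (λ i → vertex i u) (sym same)) eq)
  ... | no differ = contradiction eq (adj⇒≢ G (cross differ u v))

dense-bounded-colourable : ∀ H k a q → Colourable H (suc (suc k)) → k * suc q < a * suc k →
  ∃[ C ] (∀ G → H -Free G → (∀ v → a * order G ≤ suc q * degree G v) → Colourable G C)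
dense-bounded-colourable H k a q colouring above = n₀ , λ G free dense →
    case n₀ ≤? order G of λ where
      (yes large) → contradiction
        (copy-of-coloured colouring (proj₂ ES G (const true) (nonneighbours-few G a (suc q) dense) (whole G) large)) free
      (no small)  → colourable-mono {G} (<⇒≤ (≰⇒> small)) (order-colourable G)
  where
  b = suc q ∸ a
  ES = erdős-stone (suc q) b (suc k) (order H)
  n₀ = proj₁ ES
  -- The non-neighbours of `k + 1` vertices do not cover the graph, which is the surplus that
  -- `k + 2` parts require.
  slack : suc k * b < suc q
  slack = subst (_< suc q) (sym (*-distribˡ-∸ (suc k) (suc q) a))
    (m<n+o⇒m∸n<o (suc k * suc q) (suc k * a)
      (subst (suc q + k * suc q <_) (trans (+-comm (suc q) _) (cong (_+ suc q) (*-comm a (suc k)))) (+-monoʳ-< (suc q) above)))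
  whole : ∀ G → suc (suc k * b) * order G ≤ suc q * count {order G} (const true)
  whole G = ≤-trans (*-monoˡ-≤ (order G) slack) (≤-reflexive (cong (suc q *_) (sym (count-const-true (order G)))))

sum-of-small : ∀ {n f} c (x : Fin f → ℕ) → (∀ i → f * c * x i ≤ n) → c * sum x ≤ n
sum-of-small {n} {zero}  c x small = ≤-trans (≤-reflexive (*-zeroʳ c)) z≤n
sum-of-small {n} {suc f} c x small = *-cancelˡ-≤ (suc f) (begin
  suc f * (c * sum x)                 ≡⟨ sym (*-assoc (suc f) c (sum x)) ⟩
  suc f * c * sum x                   ≡⟨ *-distribˡ-sum (suc f * c) x ⟩
  sum (λ i → suc f * c * x i)         ≤⟨ sum-≤-const n small ⟩
  suc f * n                           ∎)
  where open ≤-Reasoning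

common-neighbour : (G : Graph) {f : ℕ} → (Fin f → Vertex G) → Vertex G → Bool
common-neighbour G y x = does (all? (λ a → Graph.adj G (y a) x ≟ᵇ true))

-- A neighbour of `z` that is missed by some `y a` lies in the symmetric difference of the
-- neighbourhoods of `y a` and `z`.
degree≤common+distances : ∀ G {f} (y : Fin f → Vertex G) z →
  degree G z ≤ count (common-neighbour G y) + sum (λ a → distance G (y a) z)
degree≤common+distances G {f} y z = begin
  degree G z                                                  ≡⟨ ∣tabulate∣≡count (adj z) ⟩
  count (adj z)                                               ≤⟨ sum-mono pointwise ⟩
  sum (λ x → bit (W x) + sum (λ a → differ a x))              ≡⟨ ∑-distrib-+ (bit ∘ W) (λ x → sum (λ a → differ a x)) ⟩
  count W + sum (λ x → sum (λ a → differ a x))                ≡⟨ cong (count W +_) (∑-comm (λ x a → differ a x)) ⟩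
  count W + sum (λ a → distance G (y a) z)                    ∎
  where
  open ≤-Reasoning
  open Graph G using (adj)
  W = common-neighbour G y
  differ : Fin f → Vertex G → ℕ
  differ a x = bit (adj (y a) x xor adj z x)
  common? : ∀ x → Dec (∀ a → adj (y a) x ≡ true)
  common? x = all? (λ a → adj (y a) x ≟ᵇ true)
  pointwise : ∀ x → bit (adj z x) ≤ bit (W x) + sum (λ a → differ a x)
  pointwise x with all? (λ a → adj (y a) x ≟ᵇ true)
  ... | yes all = ≤-trans (bit≤1 (adj z x)) (≤-trans (≤-reflexive (sym (cong bit (dec-true (common? x) all)))) (m≤m+n _ _))
    where
    bit≤1 : ∀ b → bit b ≤ 1
    bit≤1 true  = ≤-refl
    bit≤1 false = z≤n
  ... | no ¬all = let a , missed = ¬∀⟶∃¬ f _ (λ a → adj (y a) x ≟ᵇ true) ¬all in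
    ≤-trans (only-z (adj (y a) x) missed) (≤-trans (term≤sum (λ a → differ a x) a) (m≤n+m _ (bit (W x))))
    where
    only-z : ∀ b {c} → b ≢ true → bit c ≤ bit (b xor c)
    only-z true  b≢true = contradiction refl b≢true
    only-z false _      = ≤-refl

copy-of-decomposition : ∀ {H G F k} → DecompositionFamily H (suc (suc k)) F →
  (y : Vertex F → Vertex G) → Injective _≡_ _≡_ y → (∀ u v → Adj F u v → Adj G (y u) (y v)) →
  CompletePartite G (common-neighbour G y) k (order H) → Copy H G
copy-of-decomposition {H} {G} {F} {k} D y y-injective y-preserves A = record
  { to        = λ v → place v (part v) refl
  ; injective = λ {u} {v} → place-injective u v _ _ refl refl
  ; preserves = λ {u} {v} → place-preserves u v _ _ refl refl
  }
  where
  open DecompositionFamily D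
  open IsInduced induced
  open CompletePartite A renaming (injective to vertex-injective)
  index : ∀ v → part v ≡ nothing → ∃[ i ] to i ≡ v
  index v = Equivalence.to (image v)
  -- The value of `part v` is passed along with its equation, so that cases can be split on it while
  -- `index` still receives the proof.
  place : ∀ v m → part v ≡ m → Vertex G
  place v nothing  eq = y (proj₁ (index v eq))
  place v (just i) eq = vertex i v
  forest-part : ∀ a i x → Adj G (y a) (vertex i x)
  forest-part a i x = does⇒ (all? (λ a → Graph.adj G (y a) (vertex i x) ≟ᵇ true)) (inside i x) a
  place-injective : ∀ u v m n (eu : part u ≡ m) (ev : part v ≡ n) → place u m eu ≡ place v n ev → u ≡ v
  place-injective u v nothing nothing eu ev eq =
    trans (sym (proj₂ (index u eu))) (trans (cong to (y-injective eq)) (proj₂ (index v ev)))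
  place-injective u v nothing (just j) eu ev eq = contradiction eq (adj⇒≢ G (forest-part _ j v))
  place-injective u v (just i) nothing eu ev eq = contradiction (sym eq) (adj⇒≢ G (forest-part _ i u))
  place-injective u v (just i) (just j) eu ev eq with i ≟ᶠ j
  ... | yes refl = vertex-injective i eq
  ... | no  i≢j  = contradiction eq (adj⇒≢ G (cross i≢j u v))
  place-preserves : ∀ u v m n (eu : part u ≡ m) (ev : part v ≡ n) → Adj H u v → Adj G (place u m eu) (place v n ev)
  place-preserves u v nothing nothing eu ev uv = y-preserves _ _
    (trans (adjacency _ _) (subst₂ (Adj H) (sym (proj₂ (index u eu))) (sym (proj₂ (index v ev))) uv))
  place-preserves u v nothing (just j) eu ev uv = forest-part _ j v
  place-preserves u v (just i) nothing eu ev uv = adj-sym G (forest-part _ i u)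
  place-preserves u v (just i) (just j) eu ev uv with i ≟ᶠ j
  ... | yes refl = contradiction uv (independent i u v eu ev)
  ... | no  i≢j  = cross i≢j u v

forest-bounded-colourable : ∀ H k F a q → DecompositionFamily H (3 + k) F → Forest F → k * suc q < a * suc k →
  ∀ d → ∃[ C ] (∀ G → H -Free G → (∀ v → a * order G ≤ suc q * degree G v) →
    (∃[ m ] (HasVCDimension G m × m ≤ d)) → Colourable G C)
forest-bounded-colourable H k F a q D forest above d = n₀ + M * suc f , λ G free dense (m , vc , m≤d) →
    -- The strict inequality also provides the vertex from which the net is built.
    case n₀ <? order G of λ where
      (no small)  → colourable-mono {G} (≤-trans (≮⇒≥ small) (m≤m+n n₀ _)) (order-colourable G)
      (yes large) → colourable-mono {G} (m≤n+m _ n₀)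
        (colour-classes G free dense (<⇒≤ large) (proj₂ net G m (fromℕ< large) vc m≤d))
  where
  f = order F
  -- Numerators and denominators are doubled: `above` leaves a surplus of `2 n / c₂`, one half of
  -- which pays for the distances to the centre while the other is the surplus in `erdős-stone`.
  c₂ = suc q + suc q
  b = (suc q ∸ a) + (suc q ∸ a)
  ES = erdős-stone c₂ b k (order H)
  n₀ = proj₁ ES
  -- At this radius the distances of the `f` vertices of a copy of `F` to their centre sum to at
  -- most `n / c₂`.
  net = neighbourhood-net (f * c₂) d
  M = proj₁ net
  double : ∀ x y z → x * y ≤ z → (x + x) * y ≤ z + z
  double x y z le = ≤-trans (≤-reflexive (*-distribʳ-+ y x x)) (+-mono-≤ le le)

  module _ (G : Graph) (free : H -Free G) (dense : ∀ v → a * order G ≤ suc q * degree G v) (large : n₀ ≤ order G)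
    (the-net : Σ[ z ∈ (Fin M → Vertex G) ] Σ[ c ∈ (Vertex G → Fin M) ]
      (∀ v → suc (suc (f * c₂)) * distance G v (z (c v)) ≤ order G)) where
    z = proj₁ the-net
    c = proj₁ (proj₂ the-net)
    near = proj₂ (proj₂ the-net)
    class : Fin M → Vertex G → Bool
    class i v = does (c v ≟ᶠ i)

    class-has-no-core : ∀ i → ¬ Core G (class i) (suc f)
    class-has-no-core i C = free (copy-of-decomposition D to (λ {u} {v} → injective u v refl refl) (λ u v → preserves u v refl refl)
        (proj₂ ES G W sparse big large))
      where
      open ForestEmbedding forest C
      open PartialEmbedding embedding
      W = common-neighbour G to
      sparse : ∀ v → c₂ * count (not ∘ Graph.adj G v) ≤ b * order G
      sparse v = ≤-trans (double (suc q) _ _ (nonneighbours-few G a (suc q) dense v)) (≤-reflexive (sym (*-distribʳ-+ (order G) (suc q ∸ a) _)))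
      near-centre : ∀ u → f * c₂ * distance G (to u) (z i) ≤ order G
      near-centre u = ≤-trans (*-monoˡ-≤ (distance G (to u) (z i)) (m≤n+m (f * c₂) 2))
        (subst (λ j → suc (suc (f * c₂)) * distance G (to u) (z j) ≤ order G)
          (does⇒ (c (to u) ≟ᶠ i) (Core.core⊆ C (to u) (inside u))) (near (to u)))
      Δ = sum (λ u → distance G (to u) (z i))
      n = order G
      big : suc (k * b) * n ≤ c₂ * count W
      big = +-cancelʳ-≤ n _ _ (begin
        suc (k * b) * n + n                       ≡⟨ regroup k (suc q ∸ a) n ⟩
        (suc (k * (suc q ∸ a)) + suc (k * (suc q ∸ a))) * n ≤⟨ *-monoˡ-≤ n (+-mono-≤ slack slack) ⟩
        (a + a) * n                               ≡⟨ *-distribʳ-+ n a a ⟩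
        a * n + a * n                             ≤⟨ +-mono-≤ (dense (z i)) (dense (z i)) ⟩
        suc q * degree G (z i) + suc q * degree G (z i) ≡⟨ sym (*-distribʳ-+ (degree G (z i)) (suc q) (suc q)) ⟩
        c₂ * degree G (z i)                       ≤⟨ *-monoʳ-≤ c₂ (degree≤common+distances G to (z i)) ⟩
        c₂ * (count W + Δ)                        ≡⟨ *-distribˡ-+ c₂ (count W) Δ ⟩
        c₂ * count W + c₂ * Δ                     ≤⟨ +-monoʳ-≤ (c₂ * count W) (sum-of-small c₂ _ near-centre) ⟩
        c₂ * count W + n                          ∎)
        where
        open ≤-Reasoning
        slack : k * (suc q ∸ a) < a
        slack = ∸-slack k (suc q) a above
        regroup : ∀ k e n → suc (k * (e + e)) * n + n ≡ (suc (k * e) + suc (k * e)) * n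
        regroup = solve-∀

    class-colouring : ∀ i → ColourableOn G (class i) (suc f)
    class-colouring i with degenerate-or-core G (class i) f
    ... | inj₁ colouring = colouring
    ... | inj₂ core      = contradiction core (class-has-no-core i)

    colour-classes : Colourable G (M * suc f)
    colour-classes = (λ v → combine (c v) (proj₁ (class-colouring (c v)) v)) , proper
      where
      proper : ∀ u v → Adj G u v → combine (c u) (proj₁ (class-colouring (c u)) u) ≢ combine (c v) (proj₁ (class-colouring (c v)) v)
      proper u v uv eq =
        let same , colours = combine-injective (c u) _ (c v) _ eq
        in proj₂ (class-colouring (c v)) u v (dec-true (c u ≟ᶠ c v) same) (dec-true (c v ≟ᶠ c v) refl) uv
             (trans (cong (λ i → proj₁ (class-colouring i) u) (sym same)) colours)

-- Lower bounds

to-Maybe : ∀ {p} → Fin (suc p) → Maybe (Fin p)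
to-Maybe zero    = nothing
to-Maybe (suc i) = just i

to-Maybe-nothing : ∀ {p} (i : Fin (suc p)) → to-Maybe i ≡ nothing → i ≡ zero
to-Maybe-nothing zero _ = refl

to-Maybe-just : ∀ {p} (i : Fin (suc p)) {j} → to-Maybe i ≡ just j → i ≡ suc j
to-Maybe-just (suc i) refl = refl

from-Maybe : ∀ {p} → Maybe (Fin p) → Fin (suc p)
from-Maybe nothing  = zero
from-Maybe (just i) = suc i

to-from-Maybe : ∀ {p} (m : Maybe (Fin p)) → to-Maybe (from-Maybe m) ≡ m
to-from-Maybe nothing  = refl
to-from-Maybe (just i) = refl

part-graph : (H : Graph) {k : ℕ} → (Vertex H → Maybe (Fin k)) → Graph
part-graph H part = record
  { order  = count (is-nothing ∘ part)
  ; adj    = λ u v → Graph.adj H (element u) (element v)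
  ; symm   = λ u v → Graph.symm H (element u) (element v)
  ; irrefl = λ v → Graph.irrefl H (element v)
  }
  where open Enumeration (enumerate (is-nothing ∘ part))

part-graph-induced : ∀ H {k} (part : Vertex H → Maybe (Fin k)) → IsInduced (part-graph H part) H (λ v → part v ≡ nothing)
part-graph-induced H part = record
  { to        = element
  ; injective = injective
  ; image     = λ v → mk⇔ (λ eq → complete v (cong is-nothing eq)) (λ { (i , refl) → nothing! (part (element i)) (sound i) })
  ; adjacency = λ u v → refl
  }
  where
  open Enumeration (enumerate (is-nothing ∘ part))
  nothing! : ∀ {A : Set} (m : Maybe A) → is-nothing m holds → m ≡ nothing
  nothing! nothing _ = refl

-- Two colours serve `F` and one more serves each of the `p` independent sets. Applied with `2 + p`
-- below the chromatic number, this yields a contradiction.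
decomposition-colourable : ∀ {H p F} → DecompositionFamily H (2 + p) F → Colourable F 2 → Colourable H (2 + p)
decomposition-colourable {H} {p} {F} D (c , proper) =
  (λ v → colour v (part v) refl) , λ u v → distinct u v _ _ refl refl
  where
  open DecompositionFamily D
  open IsInduced induced
  index : ∀ v → part v ≡ nothing → ∃[ i ] to i ≡ v
  index v = Equivalence.to (image v)
  colour : ∀ v m → part v ≡ m → Fin (2 + p)
  colour v nothing  eq = c (proj₁ (index v eq)) ↑ˡ p
  colour v (just i) eq = 2 ↑ʳ i
  ↑ˡ≢↑ʳ : ∀ {i : Fin 2} {j : Fin p} → i ↑ˡ p ≢ 2 ↑ʳ j
  ↑ˡ≢↑ʳ {i} {j} eq = contradiction (trans (sym (splitAt-↑ˡ 2 i p)) (trans (cong (splitAt 2) eq) (splitAt-↑ʳ 2 p j))) λ ()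
  distinct : ∀ u v m n (eu : part u ≡ m) (ev : part v ≡ n) → Adj H u v → colour u m eu ≢ colour v n ev
  distinct u v nothing nothing eu ev uv eq = proper _ _
    (trans (adjacency _ _) (subst₂ (Adj H) (sym (proj₂ (index u eu))) (sym (proj₂ (index v ev))) uv)) (↑ˡ-injective p _ _ eq)
  distinct u v nothing (just j) eu ev uv eq = ↑ˡ≢↑ʳ eq
  distinct u v (just i) nothing eu ev uv eq = ↑ˡ≢↑ʳ (sym eq)
  distinct u v (just i) (just j) eu ev uv eq with ↑ʳ-injective 2 i j eq
  ... | refl = independent i u v eu ev uv

4-cycle : ∀ G {a v b w} → a ≢ b → v ≢ w → Adj G a v → Adj G v b → Adj G b w → Adj G w a → Cycle G 1
4-cycle G {a} {v} {b} {w} a≢b v≢w av vb bw wa = record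
  { vertex = f ; injective = inj ; step = λ { 0F → av ; 1F → vb ; 2F → bw } ; close = wa }
  where
  f : Fin 4 → Vertex G
  f 0F = a
  f 1F = v
  f 2F = b
  f 3F = w
  inj : Injective _≡_ _≡_ f
  inj {0F} {0F} _  = refl
  inj {0F} {1F} eq = contradiction eq (adj⇒≢ G av)
  inj {0F} {2F} eq = contradiction eq a≢b
  inj {0F} {3F} eq = contradiction (sym eq) (adj⇒≢ G wa)
  inj {1F} {0F} eq = contradiction (sym eq) (adj⇒≢ G av)
  inj {1F} {1F} _  = refl
  inj {1F} {2F} eq = contradiction eq (adj⇒≢ G vb)
  inj {1F} {3F} eq = contradiction eq v≢w
  inj {2F} {0F} eq = contradiction (sym eq) a≢b
  inj {2F} {1F} eq = contradiction (sym eq) (adj⇒≢ G vb)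
  inj {2F} {2F} _  = refl
  inj {2F} {3F} eq = contradiction eq (adj⇒≢ G bw)
  inj {3F} {0F} eq = contradiction eq (adj⇒≢ G wa)
  inj {3F} {1F} eq = contradiction (sym eq) v≢w
  inj {3F} {2F} eq = contradiction (sym eq) (adj⇒≢ G bw)
  inj {3F} {3F} _  = refl

shattered-realises : ∀ G {S} → Shattered G S → ∀ (t : Vertex G → Bool) →
  ∃[ v ] (∀ x → lookup S x holds → Graph.adj G v x ≡ t x)
shattered-realises G {S} shattered t =
  let v , eq = Equivalence.from (shattered (tabulate t ∩ S)) (p∩q⊆q (tabulate t) S)
  in v , λ x Sx → trans (sym (on-S (Graph.adj G v) x Sx)) (trans (cong (λ T → lookup T x) eq) (on-S t x Sx))
  where
  on-S : ∀ (t : Vertex G → Bool) x → lookup S x holds → lookup (tabulate t ∩ S) x ≡ t x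
  on-S t x Sx = trans (lookup-zipWith _∧_ x (tabulate t) S)
    (trans (cong₂ _∧_ (lookup∘tabulate t x) Sx) (∧-comm (t x) true))

module JoinedParts (p : ℕ) (G₀ : Graph) where
  n₀ = order G₀

  joined : ∀ {p} → Fin (suc p) → Vertex G₀ → Fin (suc p) → Vertex G₀ → Bool
  joined zero    x zero    y = Graph.adj G₀ x y
  joined zero    x (suc j) y = true
  joined (suc i) x zero    y = true
  joined (suc i) x (suc j) y = not (does (i ≟ᶠ j))

  joined-≢ : ∀ {p} {i j : Fin (suc p)} x y → i ≢ j → joined i x j y holds
  joined-≢ {i = zero}  {zero}  x y i≢j = contradiction refl i≢j
  joined-≢ {i = zero}  {suc j} x y i≢j = refl
  joined-≢ {i = suc i} {zero}  x y i≢j = refl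
  joined-≢ {i = suc i} {suc j} x y i≢j = cong not (dec-false (i ≟ᶠ j) (i≢j ∘ cong suc))

  joined-same : ∀ {p} (i : Fin (suc p)) x y → joined i x i y holds → i ≡ zero × Adj G₀ x y
  joined-same zero    x y adj = refl , adj
  joined-same (suc i) x y adj = contradiction (trans (sym adj) (cong not (dec-true (i ≟ᶠ i) refl))) λ ()

  joined-sym : ∀ {p} (i j : Fin (suc p)) x y → joined i x j y ≡ joined j y i x
  joined-sym zero    zero    x y = Graph.symm G₀ x y
  joined-sym zero    (suc j) x y = refl
  joined-sym (suc i) zero    x y = refl
  joined-sym (suc i) (suc j) x y = cong not (does-⇔ (mk⇔ sym sym) (i ≟ᶠ j) (j ≟ᶠ i))

  joined-irrefl : ∀ {p} (i : Fin (suc p)) x → joined i x i x ≡ false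
  joined-irrefl zero    x = Graph.irrefl G₀ x
  joined-irrefl (suc i) x = cong not (dec-true (i ≟ᶠ i) refl)

  part : Fin (suc p * n₀) → Fin (suc p)
  part = quotient {suc p} n₀

  base : Fin (suc p * n₀) → Vertex G₀
  base = remainder {suc p} n₀

  part-combine : ∀ i x → part (combine i x) ≡ i
  part-combine i x = cong proj₁ (remQuot-combine {suc p} i x)

  base-combine : ∀ i x → base (combine {suc p} i x) ≡ x
  base-combine i x = cong proj₂ (remQuot-combine {suc p} i x)

  part-base-≡ : ∀ {u v} → part u ≡ part v → base u ≡ base v → u ≡ v
  part-base-≡ {u} {v} same-part same-base = trans (sym (combine-remQuot {suc p} n₀ u))
    (trans (cong₂ combine same-part same-base) (combine-remQuot {suc p} n₀ v))

  graph : Graph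
  graph = record
    { order  = suc p * n₀
    ; adj    = λ u v → joined (part u) (base u) (part v) (base v)
    ; symm   = λ u v → joined-sym (part u) (part v) (base u) (base v)
    ; irrefl = λ v → joined-irrefl (part v) (base v)
    }

  adj-different : ∀ {u v} → part u ≢ part v → Adj graph u v
  adj-different = joined-≢ _ _

  adj-same : ∀ {u v} → part u ≡ part v → Adj graph u v → part v ≡ zero × Adj G₀ (base u) (base v)
  adj-same {u} {v} same uv = joined-same (part v) (base u) (base v)
    (subst (λ i → joined i (base u) (part v) (base v) holds) same uv)

  colourable-base : ∀ {k} → Colourable graph k → Colourable G₀ k
  colourable-base (c , proper) = (λ x → c (lift x)) , λ x y xy → proper (lift x) (lift y)
    (trans (cong₂ (λ i j → joined i (base (lift x)) j (base (lift y))) (part-combine zero x) (part-combine zero y))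
      (trans (cong₂ (Graph.adj G₀) (base-combine zero x) (base-combine zero y)) xy))
    where
    lift : Vertex G₀ → Vertex graph
    lift = combine {suc p} zero

  degree-large : ∀ v → p * n₀ ≤ degree graph v
  degree-large v = ≤-trans (injection⇒≤count (Graph.adj graph v) e e-injective e-adjacent) (≤-reflexive (sym (∣tabulate∣≡count (Graph.adj graph v))))
    where
    e : Fin (p * n₀) → Vertex graph
    e w = combine (punchIn (part v) (quotient {p} n₀ w)) (remainder {p} n₀ w)
    e-injective : Injective _≡_ _≡_ e
    e-injective {w} {w′} eq =
      let eq₁ , eq₂ = combine-injective _ _ _ _ eq
      in trans (sym (combine-remQuot {p} n₀ w))
           (trans (cong₂ combine (punchIn-injective (part v) _ _ eq₁) eq₂) (combine-remQuot {p} n₀ w′))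
    e-adjacent : ∀ w → Adj graph v (e w)
    e-adjacent w = adj-different (λ eq → punchInᵢ≢i (part v) (quotient {p} n₀ w) (sym (trans eq (part-combine _ _))))

  min-degree-large : p * n₀ ≤ δ graph
  min-degree-large = v≤min⁺ ≤-totalOrder (m≤n+m (p * n₀) n₀)
    (All.map⁺ {xs = allFin (order graph)} (All.tabulate (λ {v} _ → degree-large v)))

  -- All parts other than part zero are independent, hence so are their preimages. A cycle of `H`
  -- inside part zero would be a cycle of `G₀` of length at most `order H`. Here `2 + p` may differ
  -- from the chromatic number of `H`.
  copy⇒forest : ∀ {H} → GirthAbove (order H) G₀ → Copy H graph → ∃[ F ] (DecompositionFamily H (2 + p) F × Forest F)
  copy⇒forest {H} girth copy = F , record { part = π ; independent = independent ; induced = part-graph-induced H π } , forest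
    where
    open Copy copy
    π : Vertex H → Maybe (Fin p)
    π v = to-Maybe (part (to v))
    F = part-graph H π
    open IsInduced (part-graph-induced H π) using (image) renaming (to to emb; injective to emb-injective)
    independent : ∀ i u v → π u ≡ just i → π v ≡ just i → ¬ Adj H u v
    independent i u v πu πv uv =
      let u-part = to-Maybe-just _ πu
          v-part = to-Maybe-just _ πv
      in contradiction (trans (sym v-part) (proj₁ (adj-same (trans u-part (sym v-part)) (preserves uv)))) λ ()
    in-zero : ∀ i → part (to (emb i)) ≡ zero
    in-zero i = to-Maybe-nothing _ (Equivalence.from (image (emb i)) (i , refl))
    transfer : ∀ {i j} → Adj F i j → Adj G₀ (base (to (emb i))) (base (to (emb j)))
    transfer {i} {j} ij = proj₂ (adj-same (trans (in-zero i) (sym (in-zero j))) (preserves ij))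
    forest : Forest F
    forest m C = girth m (injective⇒≤ (C.injective ∘ emb-injective)) record
      { vertex    = λ i → base (to (emb (C.vertex i)))
      ; injective = λ {i} {j} eq → C.injective (emb-injective (injective
          (part-base-≡ (trans (in-zero (C.vertex i)) (sym (in-zero (C.vertex j)))) eq)))
      ; step      = λ i → transfer (C.step i)
      ; close     = transfer C.close
      }
      where module C = Cycle C

  -- A larger set has four points `e 0F`, ..., `e 3F` in one part. The vertex that realises all of
  -- them but `e i` must lie in the same part, since vertices of other parts are adjacent to `e i`.
  -- The vertices omitting `e 2F` and `e 3F` are distinct and both adjacent to `e 0F` and `e 1F`,
  -- which gives a 4-cycle in `G₀`.
  shattered-small : GirthAbove 4 G₀ → ∀ S → Shattered graph S → ∣ S ∣ ≤ suc p * 3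
  shattered-small girth S shattered = ≮⇒≥ λ large →
    let c , many = count-pigeonhole (lookup S) part 3
          (subst (suc p * 3 <_) (trans (cong ∣_∣ (sym (tabulate∘lookup S))) (∣tabulate∣≡count (lookup S))) large)
        e , e-injective , e-holds = choose (λ v → lookup S v ∧ does (part v ≟ᶠ c)) many
    in impossible c e e-injective (λ i → ∧-holdsˡ (e-holds i))
         (λ i → does⇒ (part (e i) ≟ᶠ c) (∧-holdsʳ {lookup S (e i)} (e-holds i)))
    where
    impossible : ∀ c (e : Fin 4 → Vertex graph) → Injective _≡_ _≡_ e → (∀ i → lookup S (e i) holds) → (∀ i → part (e i) ≡ c) → ⊥
    impossible c e e-injective e∈S e-part = girth 1 ≤-refl
      (4-cycle G₀ {base (e 0F)} {base v} {base (e 1F)} {base w}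
        (λ eq → contradiction (e-injective (part-base-≡ (trans (e-part 0F) (sym (e-part 1F))) eq)) λ ())
        v≢w (adj-sym G₀ (v~ 0F λ ())) (v~ 1F λ ()) (adj-sym G₀ (w~ 1F λ ())) (w~ 0F λ ()))
      where
      all-but : ∀ i → ∃[ v ] (∀ j → Graph.adj graph v (e j) ≡ not (does (e j ≟ᶠ e i)))
      all-but i = let v , agree = shattered-realises graph {S} shattered (λ x → not (does (x ≟ᶠ e i))) in
        v , λ j → agree (e j) (e∈S j)
      same-part : ∀ i → part (proj₁ (all-but i)) ≡ c
      same-part i with part (proj₁ (all-but i)) ≟ᶠ c
      ... | yes eq = eq
      ... | no ne  = contradiction
        (trans (sym (adj-different (λ eq → ne (trans eq (e-part i))))) (trans (proj₂ (all-but i) i) (cong not (dec-true (e i ≟ᶠ e i) refl)))) λ ()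
      neighbour : ∀ i j → j ≢ i → Adj G₀ (base (proj₁ (all-but i))) (base (e j))
      neighbour i j j≢i = proj₂ (adj-same (trans (same-part i) (sym (e-part j)))
        (trans (proj₂ (all-but i) j) (cong not (dec-false (e j ≟ᶠ e i) (j≢i ∘ e-injective)))))
      v = proj₁ (all-but 2F)
      w = proj₁ (all-but 3F)
      v~ : ∀ j → j ≢ 2F → Adj G₀ (base v) (base (e j))
      v~ = neighbour 2F
      w~ : ∀ j → j ≢ 3F → Adj G₀ (base w) (base (e j))
      w~ = neighbour 3F
      v≢w : base v ≢ base w
      v≢w eq = contradiction (trans (sym (cong not (dec-true (e 2F ≟ᶠ e 2F) refl))) (trans (sym (proj₂ (all-but 2F) 2F))
        (trans (cong (λ x → Graph.adj graph x (e 2F)) (part-base-≡ (trans (same-part 2F) (sym (same-part 3F))) eq))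
          (trans (proj₂ (all-but 3F) 2F) (cong not (dec-false (e 2F ≟ᶠ e 3F) (λ eq → contradiction (e-injective eq) λ ()))))))) λ ()

-- Existence of the chromatic number and of the VC-dimension by finite search.

least : ∀ {P : ℕ → Set} → (∀ k → Dec (P k)) → ∀ B → (∃[ k ] (IsMinimum P k × k ≤ B)) ⊎ (∀ j → j ≤ B → ¬ P j)
least P? zero with P? 0
... | yes P0 = inj₁ (0 , (P0 , λ _ _ → z≤n) , z≤n)
... | no ¬P0 = inj₂ λ { zero z≤n → ¬P0 }
least P? (suc B) with least P? B | P? (suc B)
... | inj₁ (k , min , k≤B) | _ = inj₁ (k , min , m≤n⇒m≤1+n k≤B)
... | inj₂ none | yes PB = inj₁ (suc B , (PB , λ j Pj → ≰⇒> (λ j≤B → none j j≤B Pj)) , ≤-refl)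
... | inj₂ none | no ¬PB = inj₂ λ j j≤1+B Pj → case m≤n⇒m<n∨m≡n j≤1+B of λ where
  (inj₁ j<1+B) → none j (≤-pred j<1+B) Pj
  (inj₂ refl)  → ¬PB Pj

greatest : ∀ {P : ℕ → Set} → (∀ k → Dec (P k)) → ∀ B → (∀ j → P j → j ≤ B) → ∃ P → ∃[ k ] IsMaximum P k
greatest P? B bound inhabited with P? B
... | yes PB = B , PB , bound
greatest {P} P? zero bound (k , Pk) | no ¬P0 = contradiction (subst P (n≤0⇒n≡0 (bound k Pk)) Pk) ¬P0
greatest P? (suc B) bound inhabited | no ¬PB = greatest P? B
  (λ j Pj → ≤-pred (≤∧≢⇒< (bound j Pj) (λ { refl → ¬PB Pj }))) inhabited

-- The search runs over codes, and decoding the code of `f` returns `f` only pointwise; hence `P`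
-- has to respect pointwise equality.
any-function? : ∀ {m n} {P : (Fin m → Fin n) → Set} → (∀ {f g} → (∀ i → f i ≡ g i) → P f → P g) →
  (∀ f → Dec (P f)) → Dec (∃[ f ] P f)
any-function? resp P? = map′ (λ (c , Pc) → finToFun c , Pc)
  (λ (f , Pf) → funToFin f , resp (λ i → sym (finToFun-funToFin f i)) Pf) (any? (λ c → P? (finToFun c)))

colourable? : ∀ G k → Dec (Colourable G k)
colourable? G k = any-function?
  (λ f≗g proper u v uv eq → proper u v uv (trans (f≗g u) (trans eq (sym (f≗g v)))))
  (λ c → all? λ u → all? λ v → (Graph.adj G u v ≟ᵇ true) →-dec ¬? (c u ≟ᶠ c v))

chromatic-number-exists : ∀ {G C} → Colourable G C → ∃[ k ] (HasChromaticNumber G k × k ≤ C)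
chromatic-number-exists {G} {C} colouring with least (colourable? G) C
... | inj₁ found = found
... | inj₂ none  = contradiction colouring (none C ≤-refl)

shattered? : ∀ G S → Dec (Shattered G S)
shattered? G S = map′ (λ none T → decidable-stable (holds? T) (λ fails → none (T , fails)))
  (λ all (T , fails) → fails (all T)) (¬? (anySubset? (λ T → ¬? (holds? T))))
  where
  holds? : ∀ T → Dec ((∃[ v ] N G v ∩ S ≡ T) ⇔ T ⊆ S)
  holds? T = map′ (λ (f , g) → mk⇔ f g) (λ e → Equivalence.to e , Equivalence.from e)
    ((realised? →-dec (T ⊆? S)) ×-dec ((T ⊆? S) →-dec realised?))
    where realised? = any? (λ v → ≡-decᵛ _≟ᵇ_ (N G v ∩ S) T)

-- The vertex `v` realises the empty trace, so the empty set is shattered and the search for a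
-- maximum has a value to start from.
vc-dimension-exists : ∀ G B → Vertex G → (∀ S → Shattered G S → ∣ S ∣ ≤ B) → ∃[ m ] (HasVCDimension G m × m ≤ B)
vc-dimension-exists G B v bound =
  let m , vc = greatest (λ k → anySubset? (λ S → shattered? G S ×-dec (∣ S ∣ ≟ k))) B
        (λ { _ (S , shattered , refl) → bound S shattered }) (∣ ⊥ˢ {order G} ∣ , ⊥ˢ , empty-shattered , refl)
      (S , shattered , eq) , _ = vc
  in m , vc , subst (_≤ B) eq (bound S shattered)
  where
  empty-shattered : Shattered G ⊥ˢ
  empty-shattered T = mk⇔ (λ { (w , refl) → p∩q⊆q (N G w) ⊥ˢ }) from
    where
    from : T ⊆ ⊥ˢ → ∃[ w ] N G w ∩ ⊥ˢ ≡ T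
    from T⊆⊥ = v , trans (∩-zeroʳ (N G v)) (⊆-antisym (⊆-min T) T⊆⊥)

-- Decidability of the criterion

-- `IsInduced` determines a graph only up to isomorphism. Transporting cycles between presentations
-- makes it enough to test one presentation of `H[B]` for each partition.
induced-cycle : ∀ {F F′ H B B′ m} → IsInduced F H B → IsInduced F′ H B′ → (∀ v → B v → B′ v) → Cycle F m → Cycle F′ m
induced-cycle {F} {F′} {H} I I′ B⊆B′ C = record
  { vertex    = pull ∘ C.vertex
  ; injective = λ eq → C.injective (I.injective (trans (sym (to-pull _)) (trans (cong I′.to eq) (to-pull _))))
  ; step      = λ i → pull-adj (C.step i)
  ; close     = pull-adj C.close
  }
  where
  module C = Cycle C
  module I = IsInduced I
  module I′ = IsInduced I′
  target : ∀ i → ∃[ j ] I′.to j ≡ I.to i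
  target i = Equivalence.to (I′.image (I.to i)) (B⊆B′ _ (Equivalence.from (I.image (I.to i)) (i , refl)))
  pull : Vertex F → Vertex F′
  pull = proj₁ ∘ target
  to-pull : ∀ i → I′.to (pull i) ≡ I.to i
  to-pull = proj₂ ∘ target
  pull-adj : ∀ {i j} → Adj F i j → Adj F′ (pull i) (pull j)
  pull-adj {i} {j} ij = trans (I′.adjacency _ _)
    (subst₂ (Adj H) (sym (to-pull i)) (sym (to-pull j)) (trans (sym (I.adjacency i j)) ij))

cycle? : ∀ G m → Dec (Cycle G m)
cycle? G m = map′
  (λ (f , inj , stp , cls) → record { vertex = f ; injective = λ {i} {j} → inj i j ; step = stp ; close = cls })
  (λ C → let open Cycle C in vertex , (λ i j → injective) , step , close)
  (any-function?
    (λ f≗g (inj , stp , cls) →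
      (λ i j eq → inj i j (trans (f≗g i) (trans eq (sym (f≗g j)))))
      , (λ i → subst₂ (Adj G) (f≗g _) (f≗g _) (stp i))
      , subst₂ (Adj G) (f≗g _) (f≗g _) cls)
    (λ f → all? (λ i → all? λ j → (f i ≟ᶠ f j) →-dec (i ≟ᶠ j))
      ×-dec all? (λ i → Graph.adj G (f (inject₁ i)) (f (suc i)) ≟ᵇ true)
      ×-dec (Graph.adj G (f (fromℕ (2 + m))) (f zero) ≟ᵇ true)))

forest? : ∀ G → Dec (Forest G)
forest? G = map′
  -- The vertices of a cycle are distinct, so `3 + m ≤ order G` and finitely many lengths remain.
  (λ none m C → let m<n = ≤-trans (m≤n+m (suc m) 2) (injective⇒≤ (Cycle.injective C)) in
    none (fromℕ< m<n) (subst (Cycle G) (sym (toℕ-fromℕ< m<n)) C))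
  (λ forest m → forest (toℕ m))
  (all? (λ (m : Fin (order G)) → ¬? (cycle? G (toℕ m))))

-- This decides which of the two values is attained. Partitions are tried one by one through their
-- codes, each with its canonical graph `part-graph` in place of an arbitrary `F`.
decomposition-forest? : ∀ H p → Dec (∃[ F ] (DecompositionFamily H (2 + p) F × Forest F))
decomposition-forest? H p = map′
  (λ (c , ind , forest) → part-graph H (decode c)
    , record { part = decode c ; independent = ind ; induced = part-graph-induced H (decode c) } , forest)
  (λ (F , D , forest) → let open DecompositionFamily D in encode part
    , (λ i u v πu πv → independent i u v (trans (sym (decode-encode part u)) πu) (trans (sym (decode-encode part v)) πv))
    , (λ m C → forest m (induced-cycle (part-graph-induced H (decode (encode part))) induced
        (λ v eq → trans (sym (decode-encode part v)) eq) C)))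
  (any? (λ c → all? (λ i → all? λ u → all? λ v → part-is? (decode c u) (just i) →-dec (part-is? (decode c v) (just i) →-dec ¬? (Graph.adj H u v ≟ᵇ true)))
    ×-dec forest? (part-graph H (decode c))))
  where
  part-is? : ∀ (m n : Maybe (Fin p)) → Dec (m ≡ n)
  part-is? = ≡-decᵐ _≟ᶠ_
  decode : Fin (suc p ^ order H) → Vertex H → Maybe (Fin p)
  decode c v = to-Maybe (finToFun c v)
  encode : (Vertex H → Maybe (Fin p)) → Fin (suc p ^ order H)
  encode part = funToFin (from-Maybe ∘ part)
  decode-encode : ∀ part v → decode (encode part) v ≡ part v
  decode-encode part v = trans (cong to-Maybe (finToFun-funToFin (from-Maybe ∘ part) v)) (to-from-Maybe (part v))

-- Thresholds as real numbers

-- A rational above `p / (d + 1)` cannot be negative, so its numerator is a natural number and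
-- clearing denominators stays within the naturals.
fraction<⇒ : ∀ p d x → (ℤ.+ p) ℚ./ suc d ℚ.< x →
  ∃[ a ] (ℚ.numerator x ≡ ℤ.+ a × p * suc (ℚ.denominator-1 x) < a * suc d)
fraction<⇒ p d (mkℚ (ℤ.+ a) e _) lt
  with ℚᵘ.<-respˡ-≃ (ℚ.toℚᵘ-fromℚᵘ (ℚᵘ.mkℚᵘ (ℤ.+ p) d)) (ℚ.toℚᵘ-mono-< lt)
... | ℚᵘ.*<* lt′ = a , refl , ℤ.drop‿+<+ (subst₂ ℤ._<_ (sym (ℤ.pos-* p (suc e))) (sym (ℤ.pos-* a (suc d))) lt′)
fraction<⇒ p d (mkℚ ℤ.-[1+ a ] e _) lt
  with ℚᵘ.<-respˡ-≃ (ℚ.toℚᵘ-fromℚᵘ (ℚᵘ.mkℚᵘ (ℤ.+ p) d)) (ℚ.toℚᵘ-mono-< lt)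
... | ℚᵘ.*<* lt′ = contradiction (subst (ℤ._< ℤ.-[1+ a ] ℤ.* ℤ.+ suc d) (sym (ℤ.pos-* p (suc e))) lt′) λ ()

fraction-scale : ∀ x {a n m} → ℚ.numerator x ≡ ℤ.+ a → x ℚ.* ((ℤ.+ n) ℚ./ 1) ℚ.≤ (ℤ.+ m) ℚ./ 1 →
  a * n ≤ suc (ℚ.denominator-1 x) * m
fraction-scale x@(mkℚ _ e _) {a} {n} {m} refl le with ℚᵘ.≤-respʳ-≃ (ℚ.toℚᵘ-fromℚᵘ (ℚᵘ.mkℚᵘ (ℤ.+ m) 0))
  (ℚᵘ.≤-respˡ-≃ (ℚᵘ.≃-trans (ℚ.toℚᵘ-homo-* x ((ℤ.+ n) ℚ./ 1))
    (ℚᵘ.*-congˡ {ℚᵘ.mkℚᵘ (ℤ.+ a) e} (ℚ.toℚᵘ-fromℚᵘ (ℚᵘ.mkℚᵘ (ℤ.+ n) 0)))) (ℚ.toℚᵘ-mono-≤ le))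
... | ℚᵘ.*≤* le′ = subst₂ _≤_ (*-identityʳ (a * n)) (trans (cong (m *_) (*-identityʳ (suc e))) (*-comm m (suc e)))
  (ℤ.drop‿+≤+ (subst₂ ℤ._≤_ (trans (cong (ℤ._* ℤ.1ℤ) (sym (ℤ.pos-* a n))) (sym (ℤ.pos-* (a * n) 1))) (sym (ℤ.pos-* m (suc e * 1))) le′))

fraction-≤ : ∀ p n m → p * n ≤ m → (ℤ.+ p ℚ./ suc p) ℚ.* ((ℤ.+ (suc p * n)) ℚ./ 1) ℚ.≤ (ℤ.+ m) ℚ./ 1
fraction-≤ p n m le = ℚ.toℚᵘ-cancel-≤ (ℚᵘ.≤-respˡ-≃ (ℚᵘ.≃-sym left) (ℚᵘ.≤-respʳ-≃ (ℚᵘ.≃-sym right) (ℚᵘ.*≤* scaled)))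
  where
  size = suc p * n
  left : ℚ.toℚᵘ ((ℤ.+ p ℚ./ suc p) ℚ.* ((ℤ.+ size) ℚ./ 1)) ℚᵘ.≃ ℚᵘ.mkℚᵘ (ℤ.+ p) p ℚᵘ.* ℚᵘ.mkℚᵘ (ℤ.+ size) 0
  left = ℚᵘ.≃-trans (ℚ.toℚᵘ-homo-* (ℤ.+ p ℚ./ suc p) ((ℤ.+ size) ℚ./ 1))
    (ℚᵘ.*-cong (ℚ.toℚᵘ-fromℚᵘ (ℚᵘ.mkℚᵘ (ℤ.+ p) p)) (ℚ.toℚᵘ-fromℚᵘ (ℚᵘ.mkℚᵘ (ℤ.+ size) 0)))
  right : ℚ.toℚᵘ ((ℤ.+ m) ℚ./ 1) ℚᵘ.≃ ℚᵘ.mkℚᵘ (ℤ.+ m) 0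
  right = ℚ.toℚᵘ-fromℚᵘ (ℚᵘ.mkℚᵘ (ℤ.+ m) 0)
  swap : ∀ p n → p * (suc p * n) * 1 ≡ p * n * (suc p * 1)
  swap = solve-∀
  scaled : ℤ.+ p ℤ.* ℤ.+ size ℤ.* ℤ.1ℤ ℤ.≤ ℤ.+ m ℤ.* ℤ.+ (suc p * 1)
  scaled = subst₂ ℤ._≤_ (trans (ℤ.pos-* (p * size) 1) (cong (ℤ._* ℤ.1ℤ) (ℤ.pos-* p size))) (ℤ.pos-* m (suc p * 1))
    (ℤ.+≤+ (≤-trans (≤-reflexive (swap p n)) (*-monoˡ-≤ (suc p * 1) le)))

fraction-increasing : ∀ k → ℤ.+ k ℚ./ suc k ℚ.< ℤ.+ suc k ℚ./ suc (suc k)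
fraction-increasing k = ℚ.toℚᵘ-cancel-<
  (ℚᵘ.<-respˡ-≃ (ℚᵘ.≃-sym (ℚ.toℚᵘ-fromℚᵘ (ℚᵘ.mkℚᵘ (ℤ.+ k) k)))
    (ℚᵘ.<-respʳ-≃ (ℚᵘ.≃-sym (ℚ.toℚᵘ-fromℚᵘ (ℚᵘ.mkℚᵘ (ℤ.+ suc k) (suc k)))) (ℚᵘ.*<* cross)))
  where
  gap : ∀ k → suc (k * suc (suc k)) ≡ suc k * suc k
  gap = solve-∀
  cross : ℤ.+ k ℤ.* ℤ.+ suc (suc k) ℤ.< ℤ.+ suc k ℤ.* ℤ.+ suc k
  cross = subst₂ ℤ._<_ (ℤ.pos-* k (suc (suc k))) (ℤ.pos-* (suc k) (suc k)) (ℤ.+<+ (≤-reflexive (gap k)))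

δ≤degree : ∀ G v → δ G ≤ degree G v
δ≤degree G v = All.lookup (min≤xs ≤-totalOrder (order G) (map (degree G) (allFin (order G)))) (∈-map⁺ (degree G) (∈-allFin v))

girth-mono : ∀ {g g′ G} → g ≤ g′ → GirthAbove g′ G → GirthAbove g G
girth-mono g≤g′ girth m short = girth m (≤-trans short g≤g′)

uncolourable⇒vertex : ∀ G {k} → ¬ Colourable G k → Vertex G
uncolourable⇒vertex G uncolourable with order-zero? (order G)
  where
  order-zero? : ∀ n → (Fin n → ⊥) ⊎ Fin n
  order-zero? zero    = inj₁ λ ()
  order-zero? (suc n) = inj₂ zero
... | inj₁ empty = contradiction ((λ v → ⊥-elim (empty v)) , λ v → ⊥-elim (empty v)) uncolourable
... | inj₂ v     = v

L<U : ∀ (y : ℝ) {p q} → ℝ.L y p → ℝ.U y q → p ℚ.< q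
L<U y {p} {q} Lp Uq with ℚ.<-cmp p q
... | tri< p<q _ _  = p<q
... | tri≈ _ refl _ = ⊥-elim (ℝ.disjoint y Lp Uq)
... | tri> _ _ q<p  = ⊥-elim (ℝ.disjoint y Lp (ℝ.U-upper y q<p Uq))

module _ (p : ℕ) (G₀ : Graph) where
  open JoinedParts p G₀

  joined-parts-dense : ∀ {s} → s ℚ.≤ p ÷ suc p → s ℚ.* (ℤ.+ order graph ℚ./ 1) ℚ.≤ ℤ.+ δ graph ℚ./ 1
  joined-parts-dense s≤ = ℚ.≤-trans
    (ℚ.*-monoʳ-≤-nonNeg (ℤ.+ order graph ℚ./ 1) {{ℚ.normalize-nonNeg (order graph) 1}} s≤)
    (fraction-≤ p n₀ (δ graph) min-degree-large)

  joined-parts-vc : ∀ {k} → GirthAbove 4 G₀ → ¬ Colourable G₀ k → ∃[ m ] (HasVCDimension graph m × m ≤ suc p * 3)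
  joined-parts-vc girth uncolourable = vc-dimension-exists graph (suc p * 3)
    (combine {suc p} zero (uncolourable⇒vertex G₀ uncolourable)) (shattered-small girth)

  joined-parts-colourable : ∀ H y q → ℝ.U y q → q ℚ.< p ÷ suc p → ∀ C →
    (∀ G → H -Free G → y · order G ≤ℕ δ G → (∃[ m ] (HasVCDimension G m × m ≤ suc p * 3)) →
      ∃[ k ] (HasChromaticNumber G k × k ≤ C)) →
    H -Free graph → GirthAbove 4 G₀ → Colourable G₀ C
  -- Colourability is decidable, so its failure may be assumed; the failure provides the vertex
  -- without which there is no VC-dimension.
  joined-parts-colourable H y q Uq q< C works free girth = decidable-stable (colourable? G₀ C) λ uncolourable →
    let k , (colouring , _) , k≤C = works graph free
          (λ s Ls → joined-parts-dense (ℚ.<⇒≤ (ℚ.<-trans (L<U y Ls Uq) q<)))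
          (joined-parts-vc girth uncolourable)
    in uncolourable (colourable-base (colourable-mono {graph} k≤C colouring))

-- Take `q′` strictly between `q` and `p / (p + 1)`. Since `y` is located, either `q` is in its
-- lower cut or `y` lies below `q′`; in the second case joined parts over a graph of large chromatic
-- number violate the bound that `y` promises.
threshold-lower : ∀ H p → (∀ G₀ → GirthAbove (order H) G₀ → H -Free JoinedParts.graph p G₀) →
  ∀ y → Admissible H y → fromℚ (p ÷ suc p) ≤ℝ y
threshold-lower H p free y (_ , bounded) q q<x = [ id , ⊥-elim ∘ refute ]′ (ℝ.located y (proj₁ (proj₂ between)))
  where
  between = ℚ.<-dense q<x
  refute : ¬ ℝ.U y (proj₁ between)
  refute Uq′ =
    let C , works = bounded (suc p * 3) (s≤s z≤n)
        -- `order H` serves the absence of copies of `H`, and 4 serves the bound on the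
        -- VC-dimension.
        G₀ , uncolourable , girth = large-girth-large-chromatic-number C (order H ⊔ 4)
    in uncolourable (joined-parts-colourable p G₀ H y (proj₁ between) Uq′ (proj₂ (proj₂ between)) C works
         (free G₀ (girth-mono {G = G₀} (m≤m⊔n (order H) 4) girth)) (girth-mono {G = G₀} (m≤n⊔m (order H) 4) girth))

BoundedAbove : Graph → ℕ → Set
BoundedAbove H p = ∀ a q → p * suc q < a * suc p → ∀ d → ∃[ C ] (∀ G → H -Free G →
  (∀ v → a * order G ≤ suc q * degree G v) → (∃[ m ] (HasVCDimension G m × m ≤ d)) → Colourable G C)

above⇒admissible : ∀ H p → BoundedAbove H p → ∀ x → p ÷ suc p ℚ.< x → Admissible H (fromℚ x)
above⇒admissible H p bounded x p/<x = ℚ.≤-<-trans (ℚ.nonNegative⁻¹ (p ÷ suc p) {{ℚ.normalize-nonNeg p (suc p)}}) p/<x , λ d _ →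
  -- The degree hypothesis for `x` speaks of rationals strictly below `x`, so the bound is taken at
  -- some `w` in between.
  let w , p/<w , w<x = ℚ.<-dense p/<x
      a , w-num , above = fraction<⇒ p p w p/<w
      C , colour = bounded a (ℚ.denominator-1 w) above d
  in C , λ G free dense vc → chromatic-number-exists {G} (colour G free
       (λ v → ≤-trans (fraction-scale w w-num (dense w w<x)) (*-monoʳ-≤ (suc (ℚ.denominator-1 w)) (δ≤degree G v))) vc)

threshold : ∀ H p → (∀ G₀ → GirthAbove (order H) G₀ → H -Free JoinedParts.graph p G₀) → BoundedAbove H p →
  HasBoundedVCThreshold H (fromℚ (p ÷ suc p))
threshold H p free bounded = threshold-lower H p free , greatest-bound
  where
  -- If `q ≥ p / (p + 1)` were in the lower cut of `z`, so would be some larger `q′`. But `q′` is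
  -- admissible and hence bounds `z` from above, which puts `q′` below itself.
  greatest-bound : ∀ z → (∀ y → Admissible H y → z ≤ℝ y) → z ≤ℝ fromℚ (p ÷ suc p)
  greatest-bound z lower q Lq = decidable-stable (q ℚ.<? p ÷ suc p) λ q≮x →
    let q′ , q<q′ , Lq′ = ℝ.L-open z Lq
    in ℚ.<-irrefl refl
         (lower (fromℚ q′) (above⇒admissible H p bounded q′ (ℚ.≤-<-trans (ℚ.≮⇒≥ q≮x) q<q′)) q′ Lq′)

infimum-unique : ∀ {P x y} → x ℚ.< y → IsInfimum P (fromℚ x) → ¬ IsInfimum P (fromℚ y)
infimum-unique {x = x} {y} x<y (_ , greatest-x) (lower-y , _) = ℚ.<-irrefl refl (greatest-x (fromℚ y) lower-y x x<y)

threshold-with-forest : ∀ H k F → HasChromaticNumber H (3 + k) → DecompositionFamily H (3 + k) F → Forest F →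
  HasBoundedVCThreshold H (fromℚ (k ÷ suc k))
threshold-with-forest H k F (_ , minimal) D forest = threshold H k
  (λ G₀ girth copy →
    let F′ , D′ , forest′ = JoinedParts.copy⇒forest k G₀ girth copy
    in <-irrefl refl (minimal (2 + k) (decomposition-colourable D′ (forest-2-colourable forest′))))
  (λ a q above → forest-bounded-colourable H k F a q D forest above)

threshold-without-forest : ∀ H k → Colourable H (3 + k) → ¬ (∃[ F ] (DecompositionFamily H (3 + k) F × Forest F)) →
  HasBoundedVCThreshold H (fromℚ (suc k ÷ suc (suc k)))
threshold-without-forest H k colouring none = threshold H (suc k)
  (λ G₀ girth copy → none (JoinedParts.copy⇒forest (suc k) G₀ girth copy))
  (λ a q above d → let C , colour = dense-bounded-colourable H (suc k) a q colouring above in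
    C , λ G free dense _ → colour G free dense)

theorem1p8 : (H : Graph) (r : ℕ) → HasChromaticNumber H r → r ≥ 3 →
    (HasBoundedVCThreshold H (fromℚ ((r ∸ 3) ÷ (r ∸ 2)))
    ⊎ HasBoundedVCThreshold H (fromℚ ((r ∸ 2) ÷ (r ∸ 1))))
    × (HasBoundedVCThreshold H (fromℚ ((r ∸ 2) ÷ (r ∸ 1)))
    ⇔ (¬ (∃[ F ] (DecompositionFamily H r F × Forest F))))
theorem1p8 H (suc (suc (suc k))) χ (s≤s (s≤s (s≤s z≤n))) = case decomposition-forest? H (suc k) of λ where
  (yes (F , D , forest)) →
    let low = threshold-with-forest H k F χ D forest
    in inj₁ low , mk⇔ (λ high → contradiction high (infimum-unique (fraction-increasing k) low))
         (λ none → contradiction (F , D , forest) none)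
  (no none) →
    let high = threshold-without-forest H k (proj₁ χ) none
    in inj₂ high , mk⇔ (λ _ → none) (λ _ → high)
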